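{- Let $A_2(n)$ denote the number of simply paired partitions of $n$ having pairing rank $-2$. For every $n\geq 0$, $$A_2(16n)\equiv0,\qquad A_2(16n+4)\equiv1,\qquad A_2(16n+8)\equiv1,\qquad A_2(16n+12)\equiv0\pmod 2.$$
   Context: A partition is simply paired if no part occurs more than three times. For a partition $\lambda$, let $r(\lambda)$ be the largest part size of multiplicity at least $2$ ($r(\lambda)=0$ if $\lambda$ has distinct parts). Let $u_1>u_2>\cdots$ be the part sizes occurring with odd multiplicity, each taken once, and let $s(\lambda)=u_1-u_2+u_3-u_4+\cdots$ ($0$ if there are none). The pairing rank is $\rho(\lambda)=r(\lambda)-s(\lambda)$. -}

module Defs where

open import Data.Integer as ℤ using (ℤ; +_)
open import Data.List.Base
  using (List; []; _∷_; concatMap; deduplicate; filter; length; map; upTo)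
open import Data.List.Extrema.Nat using (max)
open import Data.List.Membership.Propositional using (_∈_; find; lose)
open import Data.List.Membership.Propositional.Properties
  using (∈-concatMap⁺; ∈-concatMap⁻; ∈-filter⁺; ∈-filter⁻; ∈-map⁺; ∈-map⁻; ∈-upTo⁺; ∈-upTo⁻)
open import Data.List.Properties using (∷-injectiveˡ; ∷-injectiveʳ)
open import Data.List.Relation.Binary.Disjoint.Propositional using (Disjoint)
open import Data.List.Relation.Unary.All as All using (All; []; _∷_)
import Data.List.Relation.Unary.All.Properties as Allₚ
open import Data.List.Relation.Unary.AllPairs as AllPairs using ([]; _∷_)
import Data.List.Relation.Unary.AllPairs.Properties as AllPairsₚ
open import Data.List.Relation.Unary.Any using (here; there)
open import Data.List.Relation.Unary.Linked as Linked using (Linked; []; [-]; _∷_)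
open import Data.List.Relation.Unary.Unique.Propositional using (Unique)
import Data.List.Relation.Unary.Unique.Propositional.Properties as Uniqueₚ
open import Data.Nat.Base using (ℕ; zero; suc; _<_; _≤_; _≥_; z≤n; s≤s; s≤s⁻¹)
open import Data.Nat.DivMod using (_%_)
open import Data.Nat.ListAction using (sum)
open import Data.Nat.Properties
  using (_≟_; _≤?_; +-mono-≤; m≤m+n; suc-injective)
open import Data.Product.Base using (_×_; _,_; ∃)
open import Function.Bundles using (_⇔_; mk⇔)
open import Relation.Binary.PropositionalEquality using (_≡_; _≢_; refl)
open import Relation.Nullary.Decidable using (_×-dec_)
open import Relation.Unary using (Decidable)

record IsPartition (n : ℕ) (ps : List ℕ) : Set where
  field
    positive   : All (0 <_) ps
    descending : Linked _≥_ ps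
    total      : sum ps ≡ n

-- All weakly decreasing lists of length at most l with parts in {1, …, k}.
descendingLists : (l k : ℕ) → List (List ℕ)
descendingLists zero    k = [] ∷ []
descendingLists (suc l) k =
  [] ∷ concatMap (λ i → map (suc i ∷_) (descendingLists l (suc i))) (upTo k)

-- Each partition of n exactly once; see ∈-partitions and partitions-unique.
partitions : ℕ → List (List ℕ)
partitions n = filter (λ ps → sum ps ≟ n) (descendingLists n n)

multiplicity : ℕ → List ℕ → ℕ
multiplicity i ps = length (filter (_≟ i) ps)

SimplyPaired : List ℕ → Set
SimplyPaired ps = All (λ i → multiplicity i ps ≤ 3) ps

simplyPaired? : Decidable SimplyPaired
simplyPaired? ps = All.all? (λ i → multiplicity i ps ≤? 3) ps

largestRepeated : List ℕ → ℕ
largestRepeated ps = max 0 (filter (λ i → 2 ≤? multiplicity i ps) ps)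

-- deduplicate keeps first occurrences in order, so for a partition this list
-- is strictly decreasing.
oddParts : List ℕ → List ℕ
oddParts ps = filter (λ i → multiplicity i ps % 2 ≟ 1) (deduplicate _≟_ ps)

alternatingSum : List ℕ → ℤ
alternatingSum []       = + 0
alternatingSum (u ∷ us) = + u ℤ.- alternatingSum us

pairingRank : List ℕ → ℤ
pairingRank ps = + largestRepeated ps ℤ.- alternatingSum (oddParts ps)

A₂ : ℕ → ℕ
A₂ n = length
  (filter (λ ps → simplyPaired? ps ×-dec (pairingRank ps ℤ.≟ ℤ.- (+ 2))) (partitions n))

private
  block : ℕ → ℕ → List (List ℕ)
  block l i = map (suc i ∷_) (descendingLists l (suc i))

  ∈-descendingLists⁺ : ∀ l {k ps} → Linked _≥_ (k ∷ ps) → All (0 <_) ps →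
                       length ps ≤ l → ps ∈ descendingLists l k
  ∈-descendingLists⁺ zero    {ps = []}         _         _          _ = here refl
  ∈-descendingLists⁺ (suc l) {ps = []}         _         _          _ = here refl
  ∈-descendingLists⁺ (suc l) {ps = suc p ∷ ps} (k≥p ∷ d) (_ ∷ pos) len =
    there (∈-concatMap⁺ (block l) (lose (∈-upTo⁺ k≥p)
      (∈-map⁺ (suc p ∷_) (∈-descendingLists⁺ l d pos (s≤s⁻¹ len)))))

  ∈-descendingLists⁻ : ∀ l {k ps} → ps ∈ descendingLists l k →
                       Linked _≥_ (k ∷ ps) × All (0 <_) ps
  ∈-descendingLists⁻ zero    (here refl) = [-] , []
  ∈-descendingLists⁻ (suc l) (here refl) = [-] , []
  ∈-descendingLists⁻ (suc l) {k} (there ps∈)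
    with i , i∈ , ps∈′ ← find (∈-concatMap⁻ (block l) {xs = upTo k} ps∈)
    with _ , qs∈ , refl ← ∈-map⁻ (suc i ∷_) ps∈′
    with d , pos ← ∈-descendingLists⁻ l qs∈
    = ∈-upTo⁻ i∈ ∷ d , s≤s z≤n ∷ pos

  descendingLists-unique : ∀ l k → Unique (descendingLists l k)
  descendingLists-unique zero    k = [] ∷ []
  descendingLists-unique (suc l) k =
    All.tabulate (λ ps∈ → []∉ (find (∈-concatMap⁻ (block l) {xs = upTo k} ps∈)))
    ∷ Uniqueₚ.concat⁺
        (Allₚ.map⁺ (All.tabulate λ {i} _ →
          Uniqueₚ.map⁺ ∷-injectiveʳ (descendingLists-unique l (suc i))))
        (AllPairsₚ.map⁺ (AllPairs.map disjoint (Uniqueₚ.upTo⁺ k)))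
    where
    []∉ : ∀ {ps} → ∃ (λ i → i ∈ upTo k × ps ∈ block l i) → [] ≢ ps
    []∉ (i , _ , ps∈) refl with _ , _ , () ← ∈-map⁻ (suc i ∷_) ps∈

    disjoint : ∀ {i j} → i ≢ j → Disjoint (block l i) (block l j)
    disjoint {i} {j} i≢j (ps∈₁ , ps∈₂)
      with _ , _ , refl ← ∈-map⁻ (suc i ∷_) ps∈₁
      with _ , _ , eq ← ∈-map⁻ (suc j ∷_) ps∈₂
      = i≢j (suc-injective (∷-injectiveˡ eq))

  length≤sum : ∀ {ps} → All (0 <_) ps → length ps ≤ sum ps
  length≤sum []          = z≤n
  length≤sum (p>0 ∷ pos) = +-mono-≤ p>0 (length≤sum pos)

  sum∷ : ∀ {ps} → Linked _≥_ ps → Linked _≥_ (sum ps ∷ ps)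
  sum∷ {[]}     _ = [-]
  sum∷ {p ∷ ps} d = m≤m+n p (sum ps) ∷ d

∈-partitions : ∀ {n ps} → ps ∈ partitions n ⇔ IsPartition n ps
∈-partitions {n} = mk⇔ to from
  where
  to : ∀ {ps} → ps ∈ partitions n → IsPartition n ps
  to ps∈ with ps∈′ , total ← ∈-filter⁻ (λ qs → sum qs ≟ n) ps∈
         with d , pos ← ∈-descendingLists⁻ n ps∈′ =
    record { positive = pos ; descending = Linked.tail d ; total = total }

  from : ∀ {ps} → IsPartition n ps → ps ∈ partitions n
  from record { positive = pos ; descending = d ; total = refl } =
    ∈-filter⁺ (λ qs → sum qs ≟ n)
      (∈-descendingLists⁺ n (sum∷ d) pos (length≤sum pos)) refl

partitions-unique : ∀ n → Unique (partitions n)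
partitions-unique n =
  Uniqueₚ.filter⁺ (λ ps → sum ps ≟ n) (descendingLists-unique n n)

{-# OPTIONS --safe #-}
module Submission where

-- In a simply paired partition write each multiplicity as 2d + u with d, u ∈ {0,1}: this is a
-- pair (D, U) of finite sets of positive integers, of size 2|D| + |U|, and the rank is −2 iff
-- alt U = 2 + max D (max ∅ = 0). Put x = q². The sets U with alt U = s have the generating
-- function G_s = q^s / ((1 − x) ⋯ (1 − x^s)), so modulo 2 the factor (1 + x) ⋯ (1 + x^(r−1))
-- coming from the D with max D = r cancels, leaving
--   Σ A₂(n) qⁿ ≡ G₂ + Σ_{r ≥ 1} q^(3r+2) / ((1 + x^r)(1 + x^(r+1))(1 + x^(r+2))).
-- Multiply by (1 + x)³ and expand in partial fractions: the outer fractions telescope. The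
-- middle ones contribute at n ≡ 0 (mod 4) only through the number of factorisations RC = n − 1
-- with R, C ≥ 2, which is even since n − 1 ≡ 3 (mod 4) is not a square. What remains, times
-- one more factor 1 + x, is A₂(n) + A₂(n − 8) ≡ 1 for n ≡ 0 (mod 4), n ≥ 8.

open import Defs
open import Algebra.Bundles using (CommutativeRing)
import Algebra.Solver.Ring as RingSolver
open import Algebra.Solver.Ring.AlmostCommutativeRing
  using (fromCommutativeRing; _-Raw-AlmostCommutative⟶_)
open import Data.Bool.Base using (Bool; true; false; _∧_; _xor_; if_then_else_; not)
open import Data.Bool.Properties as 𝔹
  using (xor-assoc; xor-comm; xor-identityʳ; ∧-comm; ∧-zeroʳ; ∧-identityʳ; not-involutive
        ; xor-∧-commutativeRing)
open import Data.Bool.Solver using (module xor-∧-Solver)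
open import Data.Empty using (⊥)
open import Data.Integer.Base as ℤ using (+_)
import Data.Integer.Properties as ℤₚ
open import Data.Integer.Solver renaming (module +-*-Solver to ℤ-Solver)
open import Data.List.Base
  using (List; []; _∷_; _++_; cartesianProduct; deduplicate; downFrom; filter; length; map; replicate)
open import Data.List.Extrema.Nat using (max; max≈v⁺)
open import Data.List.Membership.Propositional using (_∈_)
open import Data.List.Membership.Propositional.Properties
  using (∈-++⁺ˡ; ∈-++⁺ʳ; ∈-map⁺; ∈-map⁻; ∈-filter⁺; ∈-filter⁻; ∈-cartesianProduct⁺)
open import Data.List.Membership.Propositional.Properties.WithK using (unique∧set⇒bag)
open import Data.List.Properties
  using (++-cancelˡ; filter-++; filter-all; filter-none; filter-reject; length-++; length-map
        ; length-replicate)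
open import Data.List.Relation.Binary.BagAndSetEquality using (∼bag⇒↭)
open import Data.List.Relation.Binary.Permutation.Propositional.Properties using (↭-length)
open import Data.List.Relation.Unary.All as All using (All; []; _∷_)
import Data.List.Relation.Unary.All.Properties as Allₚ
open import Data.List.Relation.Unary.AllPairs using ([]; _∷_)
open import Data.List.Relation.Unary.Any using (here)
open import Data.List.Relation.Unary.Linked as Linked using (Linked; [-]; _∷_)
open import Data.List.Relation.Unary.Unique.Propositional using (Unique)
import Data.List.Relation.Unary.Unique.Propositional.Properties as Uniqueₚ
open import Data.Maybe.Base using (Maybe; just; nothing)
open import Data.Nat.Base
  using (ℕ; zero; suc; _+_; _*_; _∸_; _≤_; _<_; _≥_; _≡ᵇ_; z≤n; s≤s; s≤s⁻¹)
open import Data.Nat.DivMod using (_%_; %-distribˡ-*; [m+kn]%n≡m%n; m%n<n)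
open import Data.Nat.ListAction using (sum)
open import Data.Nat.Properties as ℕ
  using ( _≟_; _≤?_; ≤-refl; ≤-reflexive; ≤-trans; ≤-<-trans; <-≤-trans; <-cmp; <⇒≢; >⇒≢; ≤∧≢⇒<
        ; n<1+n; n≤1+n; m≤n⇒m≤1+n; m≤n⇒m<n∨m≡n; m≤m+n; m≤m*n; m+n≤o⇒n≤o; m∸n≤m; m∸[m∸n]≡n
        ; m+n∸m≡n; m+n∸n≡m; m+[n∸m]≡n; +-suc; suc-injective; even≢odd )
open import Data.List.Membership.DecPropositional _≟_ using (_∈?_)
open import Data.Nat.Solver using (module +-*-Solver)
open import Data.Product.Base using (_×_; _,_; ∃; ∃₂; uncurry)
open import Data.Sum.Base using (inj₁; inj₂)
open import Data.Vec.Base using (Vec; []; _∷_)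
open import Data.Vec.Properties using (∷-injectiveʳ)
open import Function.Base using (_∘_)
open import Function.Bundles using (_⇔_; mk⇔; Equivalence)
open import Level using (0ℓ)
open import Relation.Binary.Definitions using (tri<; tri≈; tri>)
open import Relation.Binary.PropositionalEquality
  using (_≡_; _≢_; refl; sym; trans; cong; cong₂; module ≡-Reasoning)
import Relation.Binary.Reasoning.Setoid as SetoidReasoning
open import Relation.Nullary.Decidable
  using (does; yes; no; does-⇔; dec-false; dec-true; _×-dec_; ¬?)
open import Relation.Nullary.Negation.Core using (¬_; contradiction)
open import Relation.Unary using (Pred; Decidable)

-- Formal power series over 𝔽₂.

-- The ring 𝔽₂[[q]]; true is the coefficient 1.
Series : Set
Series = ℕ → Bool

infixl 6 _⊕_
infixl 7 _⊛_
infix 4 _≈_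

-- A record rather than a bare pointwise equation, so that both series can be inferred from the type
-- of a proof.
record _≈_ (f g : Series) : Set where
  constructor coeffs
  field at : ∀ n → f n ≡ g n
open _≈_

tail : Series → Series
tail f = f ∘ suc

0ₛ : Series
0ₛ _ = false

1ₛ : Series
1ₛ zero    = true
1ₛ (suc _) = false

q : Series
q zero    = false
q (suc n) = 1ₛ n

-- The product is the Cauchy product, computed by splitting the left factor as f = f 0 + q ·
-- `tail f`.
_⊕_ _⊛_ : Series → Series → Series
(f ⊕ g) n = f n xor g n
(f ⊛ g) zero    = f 0 ∧ g 0
(f ⊛ g) (suc n) = (f 0 ∧ g (suc n)) xor (tail f ⊛ g) n

⊛-cong′ : ∀ {f f′ g g′} → (∀ n → f n ≡ f′ n) → (∀ n → g n ≡ g′ n) →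
         ∀ n → (f ⊛ g) n ≡ (f′ ⊛ g′) n
⊛-cong′ p r zero    = cong₂ _∧_ (p 0) (r 0)
⊛-cong′ p r (suc n) = cong₂ _xor_ (cong₂ _∧_ (p 0) (r (suc n))) (⊛-cong′ (p ∘ suc) r n)

⊛-distribʳ′ : ∀ h f g n → ((f ⊕ g) ⊛ h) n ≡ ((f ⊛ h) ⊕ (g ⊛ h)) n
⊛-distribʳ′ h f g zero    = solve 3 (λ x y z → (x :+ y) :* z := x :* z :+ y :* z) refl (f 0) (g 0) (h 0)
  where open xor-∧-Solver
⊛-distribʳ′ h f g (suc n) rewrite ⊛-distribʳ′ h (tail f) (tail g) n =
  solve 5 (λ x y z u v → (x :+ y) :* z :+ (u :+ v) := (x :* z :+ u) :+ (y :* z :+ v)) refl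
    (f 0) (g 0) (h (suc n)) ((tail f ⊛ h) n) ((tail g ⊛ h) n)
  where open xor-∧-Solver

scale-⊛ : ∀ c f g n → ((λ k → c ∧ f k) ⊛ g) n ≡ c ∧ (f ⊛ g) n
scale-⊛ c f g zero    = 𝔹.∧-assoc c (f 0) (g 0)
scale-⊛ c f g (suc n) rewrite scale-⊛ c (tail f) g n =
  solve 4 (λ c x y z → (c :* x) :* y :+ c :* z := c :* (x :* y :+ z)) refl
    c (f 0) (g (suc n)) ((tail f ⊛ g) n)
  where open xor-∧-Solver

⊛-assoc′ : ∀ f g h n → ((f ⊛ g) ⊛ h) n ≡ (f ⊛ (g ⊛ h)) n
⊛-assoc′ f g h zero    = 𝔹.∧-assoc (f 0) (g 0) (h 0)
⊛-assoc′ f g h (suc n)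
  rewrite ⊛-distribʳ′ h (λ k → f 0 ∧ g (suc k)) (tail f ⊛ g) n
        | scale-⊛ (f 0) (tail g) h n
        | ⊛-assoc′ (tail f) g h n =
  solve 5 (λ x y z u v → (x :* y) :* z :+ (x :* u :+ v) := x :* (y :* z :+ u) :+ v) refl
    (f 0) (g 0) (h (suc n)) ((tail g ⊛ h) n) ((tail f ⊛ (g ⊛ h)) n)
  where open xor-∧-Solver

-- Mirror image of the defining recursion, with the constant term of the right factor split off
-- instead. It is what makes commutativity inductive.
⊛-last : ∀ f g n → (f ⊛ g) (suc n) ≡ (f (suc n) ∧ g 0) xor (f ⊛ tail g) n
⊛-last f g zero    = xor-comm (f 0 ∧ g 1) (f 1 ∧ g 0)
⊛-last f g (suc n) rewrite ⊛-last (tail f) g n =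
  solve 3 (λ x y z → x :+ (y :+ z) := y :+ (x :+ z)) refl
    (f 0 ∧ g (suc (suc n))) (f (suc (suc n)) ∧ g 0) ((tail f ⊛ tail g) n)
  where open xor-∧-Solver

⊛-comm′ : ∀ f g n → (f ⊛ g) n ≡ (g ⊛ f) n
⊛-comm′ f g zero    = ∧-comm (f 0) (g 0)
⊛-comm′ f g (suc n) = begin
  (f 0 ∧ g (suc n)) xor (tail f ⊛ g) n  ≡⟨ cong₂ _xor_ (∧-comm (f 0) (g (suc n))) (⊛-comm′ (tail f) g n) ⟩
  (g (suc n) ∧ f 0) xor (g ⊛ tail f) n  ≡⟨ ⊛-last g f n ⟨
  (g ⊛ f) (suc n)                       ∎
  where open ≡-Reasoning

⊛-zeroˡ′ : ∀ f n → (0ₛ ⊛ f) n ≡ false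
⊛-zeroˡ′ f zero    = refl
⊛-zeroˡ′ f (suc n) = ⊛-zeroˡ′ f n

⊛-identityˡ′ : ∀ f n → (1ₛ ⊛ f) n ≡ f n
⊛-identityˡ′ f zero    = refl
⊛-identityˡ′ f (suc n) = trans (cong (f (suc n) xor_) (⊛-zeroˡ′ f n)) (xor-identityʳ (f (suc n)))

seriesRing : CommutativeRing 0ℓ 0ℓ
seriesRing = record
  -- In characteristic 2 every series is its own negative.
  { Carrier = Series ; _≈_ = _≈_ ; _+_ = _⊕_ ; _*_ = _⊛_ ; -_ = λ f → f ; 0# = 0ₛ ; 1# = 1ₛ
  ; isCommutativeRing = record
    { isRing = record
      { +-isAbelianGroup = record
        { isGroup = record
          { isMonoid = record
            { isSemigroup = record
              { isMagma = record
                { isEquivalence = record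
                  { refl  = coeffs λ _ → refl
                  ; sym   = λ p → coeffs λ n → sym (at p n)
                  ; trans = λ p r → coeffs λ n → trans (at p n) (at r n)
                  }
                ; ∙-cong = λ p r → coeffs λ n → cong₂ _xor_ (at p n) (at r n)
                }
              ; assoc = λ f g h → coeffs λ n → xor-assoc (f n) (g n) (h n)
              }
            ; identity = (λ f → coeffs λ n → refl) , (λ f → coeffs λ n → xor-identityʳ (f n))
            }
          ; inverse = (λ f → coeffs λ n → 𝔹.xor-same (f n)) , (λ f → coeffs λ n → 𝔹.xor-same (f n))
          ; ⁻¹-cong = λ p → p
          }
        ; comm = λ f g → coeffs λ n → xor-comm (f n) (g n)
        }
      ; *-cong = λ p r → coeffs (⊛-cong′ (at p) (at r))
      ; *-assoc = λ f g h → coeffs (⊛-assoc′ f g h)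
      ; *-identity = (λ f → coeffs (⊛-identityˡ′ f))
                   , (λ f → coeffs λ n → trans (⊛-comm′ f 1ₛ n) (⊛-identityˡ′ f n))
      ; distrib = (λ f g h → coeffs λ n → trans (⊛-comm′ f (g ⊕ h) n)
                    (trans (⊛-distribʳ′ f g h n) (cong₂ _xor_ (⊛-comm′ g f n) (⊛-comm′ h f n))))
                , (λ f g h → coeffs (⊛-distribʳ′ f g h))
      }
    ; *-comm = λ f g → coeffs (⊛-comm′ f g)
    }
  }

open CommutativeRing seriesRing
  using (setoid; +-cong; *-cong; +-comm; +-assoc; *-comm; *-assoc; *-identityˡ; *-identityʳ;
         +-identityʳ; +-identityˡ; distribˡ; zeroˡ; zeroʳ)
  renaming (refl to ≈-refl; sym to ≈-sym; trans to ≈-trans; reflexive to ≈-reflexive)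

constant : Bool → Series
constant b = if b then 1ₛ else 0ₛ

constantMorphism :
  CommutativeRing.rawRing xor-∧-commutativeRing -Raw-AlmostCommutative⟶ fromCommutativeRing seriesRing
constantMorphism = record
  { ⟦_⟧ = constant
  ; +-homo = λ { false b     → ≈-refl
               ; true  false → ≈-sym (+-identityʳ _)
               ; true  true  → coeffs λ n → sym (𝔹.xor-same (1ₛ n)) }
  ; *-homo = λ { false b → ≈-sym (zeroˡ (constant b))
               ; true  b → ≈-sym (*-identityˡ (constant b)) }
  ; -‿homo = λ _ → ≈-refl
  ; 0-homo = ≈-refl
  ; 1-homo = ≈-refl
  }

constant≟ : ∀ b c → Maybe (constant b ≈ constant c)
constant≟ false false = just ≈-refl
constant≟ true  true  = just ≈-refl
constant≟ _     _     = nothing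

-- With 𝔽₂ as coefficient ring the solver also normalises modulo 2.
module 𝔽₂[[q]] = RingSolver (CommutativeRing.rawRing xor-∧-commutativeRing)
  (fromCommutativeRing seriesRing) constantMorphism constant≟

-- Powers of q and extraction of coefficients.

q^ : ℕ → Series
q^ zero    = 1ₛ
q^ (suc n) = q ⊛ q^ n

q⊛-suc : ∀ f n → (q ⊛ f) (suc n) ≡ f n
q⊛-suc f n = ⊛-identityˡ′ f n

q^-+ : ∀ m n → q^ (m + n) ≈ q^ m ⊛ q^ n
q^-+ zero    n = ≈-sym (*-identityˡ _)
q^-+ (suc m) n = ≈-trans (*-cong ≈-refl (q^-+ m n)) (≈-sym (*-assoc q (q^ m) (q^ n)))

q^⊛-+ : ∀ k f n → (q^ k ⊛ f) (k + n) ≡ f n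
q^⊛-+ zero    f n = ⊛-identityˡ′ f n
q^⊛-+ (suc k) f n =
  trans (at (*-assoc q (q^ k) f) (suc k + n)) (trans (q⊛-suc (q^ k ⊛ f) (k + n)) (q^⊛-+ k f n))

q^⊛-< : ∀ {k n} f → n < k → (q^ k ⊛ f) n ≡ false
q^⊛-< {suc k} {zero}  f _         = refl
q^⊛-< {suc k} {suc n} f (s≤s n<k) =
  trans (at (*-assoc q (q^ k) f) (suc n)) (trans (q⊛-suc (q^ k ⊛ f) n) (q^⊛-< f n<k))

q^-≢ : ∀ {k n} → k ≢ n → q^ k n ≡ false
q^-≢ {zero}  {zero}  0≢0 = contradiction refl 0≢0
q^-≢ {zero}  {suc n} _   = refl
q^-≢ {suc k} {zero}  _   = refl
q^-≢ {suc k} {suc n} k≢n = trans (q⊛-suc (q^ k) n) (q^-≢ (k≢n ∘ cong suc))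

q^-refl : ∀ k → q^ k k ≡ true
q^-refl zero    = refl
q^-refl (suc k) = trans (q⊛-suc (q^ k) k) (q^-refl k)

-- Coefficient n of a product sees its factors only up to degree n. This allows truncated series to
-- be replaced by their limits under a product.
⊛-cong-≤ : ∀ f {g h n} → (∀ {m} → m ≤ n → g m ≡ h m) → (f ⊛ g) n ≡ (f ⊛ h) n
⊛-cong-≤ f {n = zero}  g≡h = cong (f 0 ∧_) (g≡h z≤n)
⊛-cong-≤ f {n = suc n} g≡h =
  cong₂ _xor_ (cong (f 0 ∧_) (g≡h ≤-refl)) (⊛-cong-≤ (tail f) (g≡h ∘ m≤n⇒m≤1+n))

⊕-congˡ : ∀ f {g h} → g ≈ h → f ⊕ g ≈ f ⊕ h
⊕-congˡ f = +-cong (≈-refl {f})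

⊕-congʳ : ∀ f {g h} → g ≈ h → g ⊕ f ≈ h ⊕ f
⊕-congʳ f g≈h = +-cong g≈h (≈-refl {f})

-- Finite sums of series.

module _ {A : Set} where

  ∑ : List A → (A → Series) → Series
  ∑ []       f = 0ₛ
  ∑ (x ∷ xs) f = f x ⊕ ∑ xs f

  ∑-cong : ∀ xs {f g} → (∀ x → f x ≈ g x) → ∑ xs f ≈ ∑ xs g
  ∑-cong []       f≈g = ≈-refl
  ∑-cong (x ∷ xs) f≈g = +-cong (f≈g x) (∑-cong xs f≈g)

  ∑-++ : ∀ xs ys f → ∑ (xs ++ ys) f ≈ ∑ xs f ⊕ ∑ ys f
  ∑-++ []       ys f = ≈-refl
  ∑-++ (x ∷ xs) ys f =
    ≈-trans (⊕-congˡ (f x) (∑-++ xs ys f)) (≈-sym (+-assoc (f x) (∑ xs f) (∑ ys f)))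

  ∑-⊕ : ∀ xs f g → ∑ xs (λ x → f x ⊕ g x) ≈ ∑ xs f ⊕ ∑ xs g
  ∑-⊕ []       f g = ≈-refl
  ∑-⊕ (x ∷ xs) f g = ≈-trans (⊕-congˡ (f x ⊕ g x) (∑-⊕ xs f g))
    (solve 4 (λ a b c d → (a :+ b) :+ (c :+ d) := (a :+ c) :+ (b :+ d)) ≈-refl
      (f x) (g x) (∑ xs f) (∑ xs g))
    where open 𝔽₂[[q]]

  ∑-⊛ˡ : ∀ xs h f → ∑ xs (λ x → h ⊛ f x) ≈ h ⊛ ∑ xs f
  ∑-⊛ˡ []       h f = ≈-sym (zeroʳ h)
  ∑-⊛ˡ (x ∷ xs) h f =
    ≈-trans (⊕-congˡ (h ⊛ f x) (∑-⊛ˡ xs h f)) (≈-sym (distribˡ h (f x) (∑ xs f)))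

  ∑-coeff : ∀ xs {f g : A → Series} {n} → (∀ x → f x n ≡ g x n) → ∑ xs f n ≡ ∑ xs g n
  ∑-coeff []       f≡g = refl
  ∑-coeff (x ∷ xs) f≡g = cong₂ _xor_ (f≡g x) (∑-coeff xs f≡g)

  ∑-zero : ∀ xs {f : A → Series} {n} → (∀ x → f x n ≡ false) → ∑ xs f n ≡ false
  ∑-zero []       f≡0 = refl
  ∑-zero (x ∷ xs) f≡0 = cong₂ _xor_ (f≡0 x) (∑-zero xs f≡0)

∑-map : ∀ {A B : Set} (g : A → B) xs f → ∑ (map g xs) f ≡ ∑ xs (f ∘ g)
∑-map g []       f = refl
∑-map g (x ∷ xs) f = cong (f (g x) ⊕_) (∑-map g xs f)

-- Off the diagonal the terms at (i, j) and (j, i) cancel modulo 2.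
∑-symmetric : ∀ (f : ℕ → ℕ → Series) → (∀ i j → f i j ≈ f j i) → ∀ N →
              ∑ (downFrom N) (λ i → ∑ (downFrom N) (f i)) ≈ ∑ (downFrom N) (λ i → f i i)
∑-symmetric f f-sym zero    = ≈-refl
∑-symmetric f f-sym (suc N) = begin
  (f N N ⊕ row) ⊕ ∑ (downFrom N) (λ i → f i N ⊕ ∑ (downFrom N) (f i))
    ≈⟨ ⊕-congˡ (f N N ⊕ row) (∑-⊕ (downFrom N) (λ i → f i N) (λ i → ∑ (downFrom N) (f i))) ⟩
  (f N N ⊕ row) ⊕ (∑ (downFrom N) (λ i → f i N) ⊕ ∑ (downFrom N) (λ i → ∑ (downFrom N) (f i)))
    ≈⟨ ⊕-congˡ (f N N ⊕ row) (+-cong (∑-cong (downFrom N) (λ i → f-sym i N)) (∑-symmetric f f-sym N)) ⟩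
  (f N N ⊕ row) ⊕ (row ⊕ diagonal)
    ≈⟨ solve 3 (λ a r d → (a :+ r) :+ (r :+ d) := a :+ d) ≈-refl (f N N) row diagonal ⟩
  f N N ⊕ diagonal ∎
  where
  open SetoidReasoning setoid
  open 𝔽₂[[q]] using (solve; _:+_; _:=_)
  row diagonal : Series
  row      = ∑ (downFrom N) (f N)
  diagonal = ∑ (downFrom N) (λ i → f i i)

-- Used to complete a sum over odd indices to all indices, so that a double sum runs over a square
-- and `∑-symmetric` applies.
∑-odd : ∀ (f : ℕ → Series) {n} → (∀ i → f (i * 2) n ≡ false) → ∀ N →
        ∑ (downFrom (N * 2)) f n ≡ ∑ (downFrom N) (λ i → f (suc (i * 2))) n
∑-odd f even zero    = refl
∑-odd f {n} even (suc N) =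
  cong (f (suc (N * 2)) n xor_) (cong₂ _xor_ (even N) (∑-odd f even N))

-- Gaussian binomials in q² and their symmetry.

-- The power q^(2n), kept as a square so that the ring solver can treat `q^ n` as an atom.
x^ : ℕ → Series
x^ n = q^ n ⊛ q^ n

-- Γ i j = q^i [i+j choose i] with the Gaussian binomial taken in q²; Γ-suc is the other Pascal rule.
Γ : ℕ → ℕ → Series
Γ zero    j       = 1ₛ
Γ (suc i) zero    = q^ (suc i)
Γ (suc i) (suc j) = Γ (suc i) j ⊕ q ⊛ x^ (suc j) ⊛ Γ i (suc j)

Γ-zeroʳ : ∀ i → Γ i 0 ≈ q^ i
Γ-zeroʳ zero    = ≈-refl
Γ-zeroʳ (suc i) = ≈-refl

Γ-suc : ∀ i j → Γ (suc i) (suc j) ≈ q ⊛ Γ i (suc j) ⊕ x^ (suc i) ⊛ Γ (suc i) j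
Γ-suc zero zero =
  solve 1 (λ q → let q₁ = q :* con true in
    q₁ :+ q :* (q₁ :* q₁) :* con true := q :* con true :+ (q₁ :* q₁) :* q₁) ≈-refl q
  where open 𝔽₂[[q]]
Γ-suc zero (suc j) = begin
  Γ 1 (suc j) ⊕ q ⊛ x^ (2 + j) ⊛ 1ₛ
    ≈⟨ ⊕-congʳ (q ⊛ x^ (2 + j) ⊛ 1ₛ) (Γ-suc zero j) ⟩
  (q ⊛ 1ₛ ⊕ x^ 1 ⊛ Γ 1 j) ⊕ q ⊛ x^ (2 + j) ⊛ 1ₛ
    ≈⟨ solve 3 (λ q b g → let q₁ = q :* con true; qb = q :* b; qqb = q :* qb in
        (q :* con true :+ (q₁ :* q₁) :* g) :+ q :* (qqb :* qqb) :* con true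
        := q :* con true :+ (q₁ :* q₁) :* (g :+ q :* (qb :* qb) :* con true))
        ≈-refl q (q^ j) (Γ 1 j) ⟩
  q ⊛ 1ₛ ⊕ x^ 1 ⊛ Γ 1 (suc j) ∎
  where
  open SetoidReasoning setoid
  open 𝔽₂[[q]] using (solve; con; _:+_; _:*_; _:=_)
Γ-suc (suc i) zero = begin
  q^ (2 + i) ⊕ q ⊛ x^ 1 ⊛ Γ (suc i) 1
    ≈⟨ ⊕-congˡ (q^ (2 + i)) (*-cong (≈-refl {q ⊛ x^ 1}) (Γ-suc i zero)) ⟩
  q^ (2 + i) ⊕ q ⊛ x^ 1 ⊛ (q ⊛ Γ i 1 ⊕ x^ (suc i) ⊛ q^ (suc i))
    ≈⟨ solve 3 (λ q a g → let q₁ = q :* con true; x = q₁ :* q₁; qa = q :* a; qqa = q :* qa in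
        qqa :+ q :* x :* (q :* g :+ (qa :* qa) :* qa)
        := q :* (qa :+ q :* x :* g) :+ (qqa :* qqa) :* qqa)
        ≈-refl q (q^ i) (Γ i 1) ⟩
  q ⊛ Γ (suc i) 1 ⊕ x^ (2 + i) ⊛ q^ (2 + i) ∎
  where
  open SetoidReasoning setoid
  open 𝔽₂[[q]] using (solve; con; _:+_; _:*_; _:=_)
Γ-suc (suc i) (suc j) = begin
  Γ (2 + i) (suc j) ⊕ q ⊛ x^ (2 + j) ⊛ Γ (suc i) (2 + j)
    ≈⟨ +-cong (Γ-suc (suc i) j) (*-cong (≈-refl {q ⊛ x^ (2 + j)}) (Γ-suc i (suc j))) ⟩
  (q ⊛ Γ (suc i) (suc j) ⊕ x^ (2 + i) ⊛ Γ (2 + i) j)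
    ⊕ q ⊛ x^ (2 + j) ⊛ (q ⊛ Γ i (2 + j) ⊕ x^ (suc i) ⊛ Γ (suc i) (suc j))
    ≈⟨ solve 6 (λ q a b c d e →
        let qa = q :* a; qqa = q :* qa; qb = q :* b; qqb = q :* qb in
        (q :* c :+ qqa :* qqa :* d) :+ q :* (qqb :* qqb) :* (q :* e :+ qa :* qa :* c)
        := q :* (c :+ q :* (qqb :* qqb) :* e) :+ (qqa :* qqa) :* (d :+ q :* (qb :* qb) :* c))
        ≈-refl q (q^ i) (q^ j) (Γ (suc i) (suc j)) (Γ (2 + i) j) (Γ i (2 + j)) ⟩
  q ⊛ Γ (suc i) (2 + j) ⊕ x^ (2 + i) ⊛ Γ (2 + i) (suc j) ∎
  where
  open SetoidReasoning setoid
  open 𝔽₂[[q]] using (solve; _:+_; _:*_; _:=_)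

-- Both sides are q^(i+j) times the Gaussian binomial, which is symmetric. The induction uses one
-- Pascal rule on the left and the other on the right.
Γ-sym : ∀ i j → q^ j ⊛ Γ i j ≈ q^ i ⊛ Γ j i
Γ-sym zero j = ≈-trans (*-comm (q^ j) 1ₛ) (*-cong ≈-refl (≈-sym (Γ-zeroʳ j)))
Γ-sym (suc i) zero = *-comm 1ₛ (q^ (suc i))
Γ-sym (suc i) (suc j) = begin
  q^ (suc j) ⊛ (Γ (suc i) j ⊕ q ⊛ x^ (suc j) ⊛ Γ i (suc j))
    ≈⟨ solve 4 (λ q b c d → let qb = q :* b in
        qb :* (c :+ q :* (qb :* qb) :* d) := q :* (b :* c) :+ q :* (qb :* qb) :* (qb :* d))
        ≈-refl q (q^ j) (Γ (suc i) j) (Γ i (suc j)) ⟩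
  q ⊛ (q^ j ⊛ Γ (suc i) j) ⊕ q ⊛ x^ (suc j) ⊛ (q^ (suc j) ⊛ Γ i (suc j))
    ≈⟨ +-cong (*-cong ≈-refl (Γ-sym (suc i) j)) (*-cong (≈-refl {q ⊛ x^ (suc j)}) (Γ-sym i (suc j))) ⟩
  q ⊛ (q^ (suc i) ⊛ Γ j (suc i)) ⊕ q ⊛ x^ (suc j) ⊛ (q^ i ⊛ Γ (suc j) i)
    ≈⟨ solve 5 (λ q a b c d → let qa = q :* a; qb = q :* b in
        q :* (qa :* c) :+ q :* (qb :* qb) :* (a :* d) := qa :* (q :* c :+ (qb :* qb) :* d))
        ≈-refl q (q^ i) (q^ j) (Γ j (suc i)) (Γ (suc j) i) ⟩
  q^ (suc i) ⊛ (q ⊛ Γ j (suc i) ⊕ x^ (suc j) ⊛ Γ (suc j) i)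
    ≈⟨ *-cong (≈-refl {q^ (suc i)}) (≈-sym (Γ-suc j i)) ⟩
  q^ (suc i) ⊛ Γ (suc j) (suc i) ∎
  where
  open SetoidReasoning setoid
  open 𝔽₂[[q]] using (solve; _:+_; _:*_; _:=_)

-- Finite sets counted by size and alternating sum.

-- A vector in Vec Bool N is a subset of {1, …, N}, its head saying whether N belongs to it.
subsets : ∀ N → List (Vec Bool N)
subsets zero    = [] ∷ []
subsets (suc N) = map (false ∷_) (subsets N) ++ map (true ∷_) (subsets N)

-- The head is the largest candidate, so the recursion peels off the maximum. By `altSum≤` the
-- difference in `altSum` is never truncated.
weight altSum top : ∀ {N} → Vec Bool N → ℕ
weight             []           = 0
weight             (false ∷ U)  = weight U
weight {N = suc N} (true ∷ U)   = suc N + weight U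
altSum             []           = 0
altSum             (false ∷ U)  = altSum U
altSum {N = suc N} (true ∷ U)   = suc N ∸ altSum U
top                []           = 0
top                (false ∷ U)  = top U
top {N = suc N}    (true ∷ U)   = suc N

altSum≤ : ∀ {N} (U : Vec Bool N) → altSum U ≤ N
altSum≤             []          = z≤n
altSum≤             (false ∷ U) = m≤n⇒m≤1+n (altSum≤ U)
altSum≤ {N = suc N} (true ∷ U)  = m∸n≤m (suc N) (altSum U)

∑-subsets-suc : ∀ N f → ∑ (subsets (suc N)) f ≈
                ∑ (subsets N) (f ∘ (false ∷_)) ⊕ ∑ (subsets N) (f ∘ (true ∷_))
∑-subsets-suc N f = ≈-trans (∑-++ (map (false ∷_) (subsets N)) _ f)
  (≈-reflexive (cong₂ _⊕_ (∑-map (false ∷_) (subsets N) f) (∑-map (true ∷_) (subsets N) f)))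

selectAltSum : ∀ {N} → ℕ → Vec Bool N → Series
selectAltSum s U = if altSum U ≡ᵇ s then q^ (weight U) else 0ₛ

distinct : ℕ → ℕ → Series
distinct N s = ∑ (subsets N) (selectAltSum s)

distinct-split : ∀ N s → distinct (suc N) s ≈
                 distinct N s ⊕ ∑ (subsets N) (λ U → selectAltSum s (true ∷ U))
distinct-split N s = ∑-subsets-suc N (selectAltSum s)

-- Adjoining N + 1 as the new maximum turns alternating sum t into N + 1 - t = s.
distinct-suc : ∀ N {s t} → s + t ≡ suc N →
               distinct (suc N) s ≈ distinct N s ⊕ q^ (suc N) ⊛ distinct N t
distinct-suc N {s} {t} s+t≡1+N = ≈-trans (distinct-split N s) (⊕-congˡ (distinct N s)
  (≈-trans (∑-cong (subsets N) term) (∑-⊛ˡ (subsets N) (q^ (suc N)) (selectAltSum t))))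
  where
  complement : ∀ U → does (suc N ∸ altSum U ≟ s) ≡ does (altSum U ≟ t)
  complement U = does-⇔ (mk⇔ to from) (suc N ∸ altSum U ≟ s) (altSum U ≟ t)
    where
    to : suc N ∸ altSum U ≡ s → altSum U ≡ t
    to U≡s = trans (sym (m∸[m∸n]≡n (m≤n⇒m≤1+n (altSum≤ U))))
      (trans (cong₂ _∸_ (sym s+t≡1+N) U≡s) (m+n∸m≡n s t))
    from : altSum U ≡ t → suc N ∸ altSum U ≡ s
    from U≡t = trans (cong (suc N ∸_) U≡t) (trans (cong (_∸ t) (sym s+t≡1+N)) (m+n∸n≡m s t))

  term : ∀ U → selectAltSum s (true ∷ U) ≈ q^ (suc N) ⊛ selectAltSum t U
  term U rewrite complement U with does (altSum U ≟ t)
  ... | true  = q^-+ (suc N) (weight U)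
  ... | false = ≈-sym (zeroʳ (q^ (suc N)))

distinct-> : ∀ {N s} → N < s → distinct N s ≈ 0ₛ
distinct-> {N} {s} N<s = coeffs λ n → ∑-zero (subsets N) λ U →
  cong (λ b → (if b then q^ (weight U) else 0ₛ) n)
    (dec-false (altSum U ≟ s) (<⇒≢ (≤-<-trans (altSum≤ U) N<s)))

-- The recurrence `distinct-suc` complements the alternating sum and so mixes Γ i j with Γ j i;
-- after `Γ-sym` it becomes the defining Pascal rule. The induction is on N because the recursive
-- calls swap the indices.
distinct-Γ : ∀ N i j → i + j ≡ N → distinct N i ≈ Γ i j
distinct-Γ zero zero zero _ = +-identityʳ 1ₛ
distinct-Γ (suc N) zero (suc j) refl = begin
  distinct (suc j) 0
    ≈⟨ distinct-suc j refl ⟩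
  distinct j 0 ⊕ q^ (suc j) ⊛ distinct j (suc j)
    ≈⟨ +-cong (distinct-Γ j 0 j refl) (*-cong (≈-refl {q^ (suc j)}) (distinct-> (n<1+n j))) ⟩
  1ₛ ⊕ q^ (suc j) ⊛ 0ₛ
    ≈⟨ ⊕-congˡ 1ₛ (zeroʳ (q^ (suc j))) ⟩
  1ₛ ⊕ 0ₛ
    ≈⟨ +-identityʳ 1ₛ ⟩
  1ₛ ∎
  where open SetoidReasoning setoid
distinct-Γ (suc N) (suc i) zero i+0≡N
  with refl ← suc-injective (trans (sym (ℕ.+-identityʳ (suc i))) i+0≡N) = begin
  distinct (suc N) (suc N)
    ≈⟨ distinct-suc N (ℕ.+-identityʳ (suc N)) ⟩
  distinct N (suc N) ⊕ q^ (suc N) ⊛ distinct N 0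
    ≈⟨ +-cong (distinct-> (n<1+n N)) (*-cong (≈-refl {q^ (suc N)}) (distinct-Γ N 0 N refl)) ⟩
  0ₛ ⊕ q^ (suc N) ⊛ 1ₛ
    ≈⟨ +-identityˡ (q^ (suc N) ⊛ 1ₛ) ⟩
  q^ (suc N) ⊛ 1ₛ
    ≈⟨ *-identityʳ (q^ (suc N)) ⟩
  q^ (suc N) ∎
  where open SetoidReasoning setoid
distinct-Γ (suc N) (suc i) (suc j) refl = begin
  distinct (suc N) (suc i)
    ≈⟨ distinct-suc N refl ⟩
  distinct N (suc i) ⊕ q^ (suc i + suc j) ⊛ distinct N (suc j)
    ≈⟨ +-cong (distinct-Γ N (suc i) j (sym (+-suc i j)))
         (*-cong (q^-+ (suc i) (suc j)) (distinct-Γ N (suc j) i (ℕ.+-comm (suc j) i))) ⟩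
  Γ (suc i) j ⊕ q^ (suc i) ⊛ q^ (suc j) ⊛ Γ (suc j) i
    ≈⟨ solve 5 (λ q a b c d → let qa = q :* a; qb = q :* b in
        c :+ qa :* qb :* d := c :+ q :* qb :* (a :* d))
        ≈-refl q (q^ i) (q^ j) (Γ (suc i) j) (Γ (suc j) i) ⟩
  Γ (suc i) j ⊕ q ⊛ q^ (suc j) ⊛ (q^ i ⊛ Γ (suc j) i)
    ≈⟨ ⊕-congˡ (Γ (suc i) j) (*-cong (≈-refl {q ⊛ q^ (suc j)}) (≈-sym (Γ-sym i (suc j)))) ⟩
  Γ (suc i) j ⊕ q ⊛ q^ (suc j) ⊛ (q^ (suc j) ⊛ Γ i (suc j))
    ≈⟨ solve 4 (λ q b c d → c :+ q :* b :* (b :* d) := c :+ q :* (b :* b) :* d)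
        ≈-refl q (q^ (suc j)) (Γ (suc i) j) (Γ i (suc j)) ⟩
  Γ (suc i) (suc j) ∎
  where
  open SetoidReasoning setoid
  open 𝔽₂[[q]] using (solve; _:+_; _:*_; _:=_)

-- The second Pascal rule, carried over to sets. Unlike in `distinct-suc`, the coefficients do not
-- involve N, so the rule survives the limit of large N. At s = N one term vanishes, beyond it all
-- do.
distinct-Pascal : ∀ N s → distinct (suc N) (suc s) ≈
                  q ⊛ distinct N s ⊕ x^ (suc s) ⊛ distinct N (suc s)
distinct-Pascal N s with <-cmp s N
... | tri< s<N _ _ = begin
  distinct (suc N) (suc s)
    ≈⟨ distinct-Γ (suc N) (suc s) (suc j) (cong suc (trans (+-suc s j) s+j+1≡N)) ⟩
  Γ (suc s) (suc j)
    ≈⟨ Γ-suc s j ⟩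
  q ⊛ Γ s (suc j) ⊕ x^ (suc s) ⊛ Γ (suc s) j
    ≈⟨ +-cong (*-cong (≈-refl {q}) (distinct-Γ N s (suc j) (trans (+-suc s j) s+j+1≡N)))
              (*-cong (≈-refl {x^ (suc s)}) (distinct-Γ N (suc s) j s+j+1≡N)) ⟨
  q ⊛ distinct N s ⊕ x^ (suc s) ⊛ distinct N (suc s) ∎
  where
  open SetoidReasoning setoid
  j : ℕ
  j = N ∸ suc s
  s+j+1≡N : suc s + j ≡ N
  s+j+1≡N = m+[n∸m]≡n s<N
... | tri≈ _ refl _ = begin
  distinct (suc s) (suc s)
    ≈⟨ distinct-Γ (suc s) (suc s) 0 (ℕ.+-identityʳ (suc s)) ⟩
  q ⊛ q^ s
    ≈⟨ *-cong (≈-refl {q}) (≈-trans (distinct-Γ s s 0 (ℕ.+-identityʳ s)) (Γ-zeroʳ s)) ⟨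
  q ⊛ distinct s s
    ≈⟨ solve 2 (λ x a → a := a :+ x :* con false) ≈-refl (x^ (suc s)) (q ⊛ distinct s s) ⟩
  q ⊛ distinct s s ⊕ x^ (suc s) ⊛ 0ₛ
    ≈⟨ ⊕-congˡ (q ⊛ distinct s s) (*-cong (≈-refl {x^ (suc s)}) (distinct-> (n<1+n s))) ⟨
  q ⊛ distinct s s ⊕ x^ (suc s) ⊛ distinct s (suc s) ∎
  where
  open SetoidReasoning setoid
  open 𝔽₂[[q]] using (solve; con; _:+_; _:*_; _:=_)
... | tri> _ _ s>N = begin
  distinct (suc N) (suc s)
    ≈⟨ distinct-> (s≤s s>N) ⟩
  0ₛ
    ≈⟨ solve 2 (λ q x → con false := q :* con false :+ x :* con false) ≈-refl q (x^ (suc s)) ⟩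
  q ⊛ 0ₛ ⊕ x^ (suc s) ⊛ 0ₛ
    ≈⟨ +-cong (*-cong (≈-refl {q}) (distinct-> s>N))
              (*-cong (≈-refl {x^ (suc s)}) (distinct-> (m≤n⇒m≤1+n s>N))) ⟨
  q ⊛ distinct N s ⊕ x^ (suc s) ⊛ distinct N (suc s) ∎
  where
  open SetoidReasoning setoid
  open 𝔽₂[[q]] using (solve; con; _:+_; _:*_; _:=_)

-- A set containing N + 1 has size greater than n, so it does not reach degree n.
distinct-suc-coeff : ∀ {n N} s → n ≤ N → distinct (suc N) s n ≡ distinct N s n
distinct-suc-coeff {n} {N} s n≤N = trans (at (distinct-split N s) n)
  (trans (cong (distinct N s n xor_) (∑-zero (subsets N) vanish)) (xor-identityʳ (distinct N s n)))
  where
  vanish : ∀ (U : Vec Bool N) → selectAltSum s (true ∷ U) n ≡ false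
  vanish U with suc N ∸ altSum U ≡ᵇ s
  ... | true  = q^-≢ (>⇒≢ (≤-trans (s≤s n≤N) (m≤m+n (suc N) (weight U))))
  ... | false = refl

-- The limit series and their closed form.

-- distinct N s is independent of N ≥ n in degree n, so the diagonal is the limit.
G : ℕ → Series
G s n = distinct n s n

distinct-G : ∀ {n N} s → n ≤ N → distinct N s n ≡ G s n
distinct-G {n} {N} s n≤N with m≤n⇒m<n∨m≡n n≤N
... | inj₂ refl = refl
distinct-G {n} {suc N} s n≤N | inj₁ (s≤s n≤N′) =
  trans (distinct-suc-coeff s n≤N′) (distinct-G s n≤N′)

G-zero : G 0 ≈ 1ₛ
G-zero = coeffs λ n → at (distinct-Γ n 0 n refl) n

M : ℕ → Series
M i = 1ₛ ⊕ x^ i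

-- The limit of `distinct-Pascal`, solved for `G (suc s)`: each factor 1 + x^(s+1) removes one
-- denominator.
M⊛G : ∀ s → M (suc s) ⊛ G (suc s) ≈ q ⊛ G s
M⊛G s = begin
  M (suc s) ⊛ G (suc s)
    ≈⟨ solve 2 (λ x g → (con true :+ x) :* g := x :* g :+ g) ≈-refl (x^ (suc s)) (G (suc s)) ⟩
  x^ (suc s) ⊛ G (suc s) ⊕ G (suc s)
    ≈⟨ ⊕-congˡ (x^ (suc s) ⊛ G (suc s)) pascal ⟩
  x^ (suc s) ⊛ G (suc s) ⊕ (q ⊛ G s ⊕ x^ (suc s) ⊛ G (suc s))
    ≈⟨ solve 2 (λ a b → a :+ (b :+ a) := b) ≈-refl (x^ (suc s) ⊛ G (suc s)) (q ⊛ G s) ⟩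
  q ⊛ G s ∎
  where
  open SetoidReasoning setoid
  open 𝔽₂[[q]] using (solve; con; _:+_; _:*_; _:=_)
  pascal : G (suc s) ≈ q ⊛ G s ⊕ x^ (suc s) ⊛ G (suc s)
  -- In degree n the finite rule at N = n already agrees with the limit.
  pascal = coeffs λ n → trans (sym (distinct-suc-coeff (suc s) (≤-refl {n})))
    (trans (at (distinct-Pascal n s) n)
      (cong₂ _xor_ (⊛-cong-≤ q {n = n} (distinct-G s))
                   (⊛-cong-≤ (x^ (suc s)) {n = n} (distinct-G (suc s)))))

-- The product (1 + x)(1 + x²) ⋯ (1 + x^k). Modulo 2 it is at once the denominator of `G k` and the
-- generating function in x of the subsets of {1, ..., k}.
Π : ℕ → Series
Π zero    = 1ₛ
Π (suc k) = M (suc k) ⊛ Π k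

-- Descending to `G 0` by `M⊛G` gives the closed form of `G k`, stated without division.
Π⊛G : ∀ k → Π k ⊛ G k ≈ q^ k
Π⊛G zero    = ≈-trans (*-identityˡ (G 0)) G-zero
Π⊛G (suc k) = begin
  M (suc k) ⊛ Π k ⊛ G (suc k)
    ≈⟨ solve 3 (λ m p g → m :* p :* g := p :* (m :* g)) ≈-refl (M (suc k)) (Π k) (G (suc k)) ⟩
  Π k ⊛ (M (suc k) ⊛ G (suc k))
    ≈⟨ *-cong (≈-refl {Π k}) (M⊛G k) ⟩
  Π k ⊛ (q ⊛ G k)
    ≈⟨ solve 3 (λ q p g → p :* (q :* g) := q :* (p :* g)) ≈-refl q (Π k) (G k) ⟩
  q ⊛ (Π k ⊛ G k)
    ≈⟨ *-cong (≈-refl {q}) (Π⊛G k) ⟩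
  q^ (suc k) ∎
  where
  open SetoidReasoning setoid
  open 𝔽₂[[q]] using (solve; _:*_; _:=_)

-- The single fraction q^(k+1) / (1 + x^(k+1)), since only the last denominator of `G (suc k)` is
-- left.
Y : ℕ → Series
Y k = Π k ⊛ G (suc k)

Y-geometric : ∀ k → Y k ≈ q^ (suc k) ⊕ x^ (suc k) ⊛ Y k
Y-geometric k = begin
  Π k ⊛ G (suc k)
    ≈⟨ solve 3 (λ x p g → p :* g := (con true :+ x) :* p :* g :+ x :* (p :* g))
         ≈-refl (x^ (suc k)) (Π k) (G (suc k)) ⟩
  Π (suc k) ⊛ G (suc k) ⊕ x^ (suc k) ⊛ Y k
    ≈⟨ ⊕-congʳ (x^ (suc k) ⊛ Y k) (Π⊛G (suc k)) ⟩
  q^ (suc k) ⊕ x^ (suc k) ⊛ Y k ∎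
  where
  open SetoidReasoning setoid
  open 𝔽₂[[q]] using (solve; con; _:+_; _:*_; _:=_)

x^-+ : ∀ m n → x^ (m + n) ≈ x^ m ⊛ x^ n
x^-+ m n = ≈-trans (*-cong (q^-+ m n) (q^-+ m n))
  (solve 2 (λ a b → (a :* b) :* (a :* b) := (a :* a) :* (b :* b)) ≈-refl (q^ m) (q^ n))
  where open 𝔽₂[[q]]

∑-x^weight : ∀ N → ∑ (subsets N) (x^ ∘ weight) ≈ Π N
∑-x^weight zero    = ≈-trans (+-identityʳ (x^ 0)) (*-identityˡ 1ₛ)
∑-x^weight (suc N) = begin
  ∑ (subsets (suc N)) (x^ ∘ weight)
    ≈⟨ ∑-subsets-suc N (x^ ∘ weight) ⟩
  ∑ (subsets N) (x^ ∘ weight) ⊕ ∑ (subsets N) (λ D → x^ (suc N + weight D))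
    ≈⟨ ⊕-congˡ (∑ (subsets N) (x^ ∘ weight)) (≈-trans (∑-cong (subsets N) (x^-+ (suc N) ∘ weight))
         (∑-⊛ˡ (subsets N) (x^ (suc N)) (x^ ∘ weight))) ⟩
  ∑ (subsets N) (x^ ∘ weight) ⊕ x^ (suc N) ⊛ ∑ (subsets N) (x^ ∘ weight)
    ≈⟨ +-cong (∑-x^weight N) (*-cong (≈-refl {x^ (suc N)}) (∑-x^weight N)) ⟩
  Π N ⊕ x^ (suc N) ⊛ Π N
    ≈⟨ solve 2 (λ x p → p :+ x :* p := (con true :+ x) :* p) ≈-refl (x^ (suc N)) (Π N) ⟩
  Π (suc N) ∎
  where
  open SetoidReasoning setoid
  open 𝔽₂[[q]] using (solve; con; _:+_; _:*_; _:=_)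

-- The empty set gives `h 0`. A set with maximum k + 1 consists of k + 1, contributing x^(k+1), and
-- an arbitrary subset of {1, ..., k}, contributing `Π k` in total.
∑-by-top : ∀ N (h : ℕ → Series) → ∑ (subsets N) (λ D → x^ (weight D) ⊛ h (top D)) ≈
           h 0 ⊕ ∑ (downFrom N) (λ k → x^ (suc k) ⊛ Π k ⊛ h (suc k))
∑-by-top zero    h = ⊕-congʳ 0ₛ
  (solve 1 (λ a → (con true :* con true) :* a := a) ≈-refl (h 0))
  where open 𝔽₂[[q]]
∑-by-top (suc N) h = begin
  ∑ (subsets (suc N)) (λ D → x^ (weight D) ⊛ h (top D))
    ≈⟨ ∑-subsets-suc N (λ D → x^ (weight D) ⊛ h (top D)) ⟩
  ∑ (subsets N) (λ D → x^ (weight D) ⊛ h (top D))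
    ⊕ ∑ (subsets N) (λ D → x^ (suc N + weight D) ⊛ h (suc N))
    ≈⟨ +-cong (∑-by-top N h) (∑-cong (subsets N) term) ⟩
  (h 0 ⊕ rest) ⊕ ∑ (subsets N) (λ D → x^ (suc N) ⊛ h (suc N) ⊛ x^ (weight D))
    ≈⟨ ⊕-congˡ (h 0 ⊕ rest) (≈-trans (∑-⊛ˡ (subsets N) (x^ (suc N) ⊛ h (suc N)) (x^ ∘ weight))
         (*-cong (≈-refl {x^ (suc N) ⊛ h (suc N)}) (∑-x^weight N))) ⟩
  (h 0 ⊕ rest) ⊕ x^ (suc N) ⊛ h (suc N) ⊛ Π N
    ≈⟨ solve 5 (λ a r x b p → (a :+ r) :+ x :* b :* p := a :+ (x :* p :* b :+ r)) ≈-refl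
         (h 0) rest (x^ (suc N)) (h (suc N)) (Π N) ⟩
  h 0 ⊕ (x^ (suc N) ⊛ Π N ⊛ h (suc N) ⊕ rest) ∎
  where
  open SetoidReasoning setoid
  open 𝔽₂[[q]] using (solve; _:+_; _:*_; _:=_)
  rest : Series
  rest = ∑ (downFrom N) (λ k → x^ (suc k) ⊛ Π k ⊛ h (suc k))
  term : ∀ (D : Vec Bool N) → x^ (suc N + weight D) ⊛ h (suc N) ≈ x^ (suc N) ⊛ h (suc N) ⊛ x^ (weight D)
  term D = ≈-trans (*-cong (x^-+ (suc N) (weight D)) (≈-refl {h (suc N)}))
    (solve 3 (λ x w a → x :* w :* a := x :* a :* w) ≈-refl (x^ (suc N)) (x^ (weight D)) (h (suc N)))

-- Partial fractions and telescoping.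

-- `X k` is the contribution of the D with maximum r = k + 1. `C` supplies its outer partial
-- fractions and `E` the middle one; in closed form `E k` is q^(3R+1) / (1 + q^(2R)) with R = k + 2.
X C E : ℕ → Series
X k = x^ (suc k) ⊛ Π k ⊛ G (3 + k)
C k = x^ (suc k) ⊛ x^ 1 ⊛ Y k
E k = q ⊛ x^ (2 + k) ⊛ Y (suc k)

-- With x = q² and y = x^ (suc k), this rests on the partial fraction decomposition in y of
-- (1+x)³/((1+y)(1+xy)(1+x²y)), multiplied out as M⊛G removes one denominator at a time.
X-partialFractions : ∀ k → M 1 ⊛ M 1 ⊛ M 1 ⊛ X k ≈ (C k ⊕ C (2 + k)) ⊕ M 1 ⊛ E k
X-partialFractions k = begin
  M 1 ⊛ M 1 ⊛ M 1 ⊛ X k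
    -- This is (1+x)³ = (1+xy)(1+x²y) + x³(1+y)(1+xy) + x(1+x)(1+y)(1+x²y) modulo 2, multiplied by
    -- `X k`.
    ≈⟨ solve 4 (λ q a p g →
        let q₁ = q :* con true; x = q₁ :* q₁; m = con true :+ x
            a₁ = q :* a; a₂ = q :* a₁; a₃ = q :* a₂
            y = a₁ :* a₁; m₁ = con true :+ y; m₂ = con true :+ a₂ :* a₂; m₃ = con true :+ a₃ :* a₃ in
        m :* m :* m :* (y :* p :* g)
        := (y :* (p :* (m₂ :* (m₃ :* g))) :+ y :* x :* x :* x :* (m₂ :* (m₁ :* p) :* g))
           :+ y :* x :* m :* (m₁ :* p :* (m₃ :* g)))
        ≈-refl q (q^ k) (Π k) (G (3 + k)) ⟩
  (y ⊛ (Π k ⊛ (M (2 + k) ⊛ (M (3 + k) ⊛ G (3 + k)))) ⊕ y ⊛ x^ 1 ⊛ x^ 1 ⊛ x^ 1 ⊛ Y (2 + k))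
    ⊕ y ⊛ x^ 1 ⊛ M 1 ⊛ (Π (suc k) ⊛ (M (3 + k) ⊛ G (3 + k)))
    ≈⟨ +-cong (⊕-congʳ (y ⊛ x^ 1 ⊛ x^ 1 ⊛ x^ 1 ⊛ Y (2 + k))
                (*-cong (≈-refl {y}) (*-cong (≈-refl {Π k}) (*-cong (≈-refl {M (2 + k)}) (M⊛G (2 + k))))))
              (*-cong (≈-refl {y ⊛ x^ 1 ⊛ M 1}) (*-cong (≈-refl {Π (suc k)}) (M⊛G (2 + k)))) ⟩
  (y ⊛ (Π k ⊛ (M (2 + k) ⊛ (q ⊛ G (2 + k)))) ⊕ y ⊛ x^ 1 ⊛ x^ 1 ⊛ x^ 1 ⊛ Y (2 + k))
    ⊕ y ⊛ x^ 1 ⊛ M 1 ⊛ (Π (suc k) ⊛ (q ⊛ G (2 + k)))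
    ≈⟨ ⊕-congʳ (y ⊛ x^ 1 ⊛ M 1 ⊛ (Π (suc k) ⊛ (q ⊛ G (2 + k))))
         (⊕-congʳ (y ⊛ x^ 1 ⊛ x^ 1 ⊛ x^ 1 ⊛ Y (2 + k)) (*-cong (≈-refl {y}) (*-cong (≈-refl {Π k}) M⊛q⊛G))) ⟩
  (y ⊛ (Π k ⊛ (q ⊛ (q ⊛ G (suc k)))) ⊕ y ⊛ x^ 1 ⊛ x^ 1 ⊛ x^ 1 ⊛ Y (2 + k))
    ⊕ y ⊛ x^ 1 ⊛ M 1 ⊛ (Π (suc k) ⊛ (q ⊛ G (2 + k)))
    ≈⟨ solve 7 (λ q a p p₁ g g₁ w →
        let q₁ = q :* con true; x = q₁ :* q₁; m = con true :+ x
            a₁ = q :* a; a₂ = q :* a₁; a₃ = q :* a₂; y = a₁ :* a₁ in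
        (y :* (p :* (q :* (q :* g))) :+ y :* x :* x :* x :* w) :+ y :* x :* m :* (p₁ :* (q :* g₁))
        := (y :* x :* (p :* g) :+ (a₃ :* a₃) :* x :* w) :+ m :* (q :* (a₂ :* a₂) :* (p₁ :* g₁)))
        ≈-refl q (q^ k) (Π k) (Π (suc k)) (G (suc k)) (G (2 + k)) (Y (2 + k)) ⟩
  (C k ⊕ C (2 + k)) ⊕ M 1 ⊛ E k ∎
  where
  open SetoidReasoning setoid
  open 𝔽₂[[q]] using (solve; con; _:+_; _:*_; _:=_)
  y : Series
  y = x^ (suc k)
  M⊛q⊛G : M (2 + k) ⊛ (q ⊛ G (2 + k)) ≈ q ⊛ (q ⊛ G (suc k))
  M⊛q⊛G = ≈-trans
    (solve 3 (λ q m g → m :* (q :* g) := q :* (m :* g)) ≈-refl q (M (2 + k)) (G (2 + k)))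
    (*-cong (≈-refl {q}) (M⊛G (suc k)))

-- Modulo 2 a sum serves as a difference; the step of two leaves two boundary terms at each end.
∑-telescope : ∀ (f : ℕ → Series) N →
              ∑ (downFrom N) (λ k → f k ⊕ f (2 + k)) ≈ (f 0 ⊕ f 1) ⊕ (f N ⊕ f (suc N))
∑-telescope f zero    = solve 2 (λ a b → con false := (a :+ b) :+ (a :+ b)) ≈-refl (f 0) (f 1)
  where open 𝔽₂[[q]]
∑-telescope f (suc N) = ≈-trans (⊕-congˡ (f N ⊕ f (2 + N)) (∑-telescope f N))
  (solve 5 (λ a b c d e → (c :+ e) :+ ((a :+ b) :+ (c :+ d)) := (a :+ b) :+ (d :+ e)) ≈-refl
    (f 0) (f 1) (f N) (f (suc N)) (f (2 + N)))
  where open 𝔽₂[[q]]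

-- Modulo 2 and up to degree N this is the generating function of A₂.
S : ℕ → Series
S N = G 2 ⊕ ∑ (downFrom N) X

-- The multiplier is (1 + x)⁴ modulo 2. Three factors serve the partial fractions; the fourth turns
-- the multiplier of the middle ones into 1 + q⁴ and clears the denominator 1 + x of `Y 0`, leaving
-- q⁵. The term `G 2` leaves q² + q⁴.
S-equation : ∀ N → (1ₛ ⊕ q^ 8) ⊛ S N ≈
  ((q^ 2 ⊕ q^ 4 ⊕ q^ 5) ⊕ (q^ 6 ⊛ Y 1 ⊕ q^ 8 ⊛ Y 1))
  ⊕ ((1ₛ ⊕ q^ 4) ⊛ ∑ (downFrom N) E ⊕ M 1 ⊛ (C N ⊕ C (suc N)))
S-equation N = begin
  (1ₛ ⊕ q^ 8) ⊛ S N
    ≈⟨ solve 3 (λ q g s →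
        let q₁ = q :* con true; q₂ = q :* q₁; x = q₁ :* q₁; m = con true :+ x; m₂ = con true :+ q₂ :* q₂
            q₈ = q :* (q :* (q :* (q :* (q :* (q :* q₂))))) in
        (con true :+ q₈) :* (g :+ s) := m :* (m₂ :* (m :* con true) :* g) :+ m :* (m :* m :* m :* s))
        ≈-refl q (G 2) (∑ (downFrom N) X) ⟩
  M 1 ⊛ (Π 2 ⊛ G 2) ⊕ M 1 ⊛ (M 1 ⊛ M 1 ⊛ M 1 ⊛ ∑ (downFrom N) X)
    ≈⟨ +-cong (*-cong (≈-refl {M 1}) (Π⊛G 2)) (*-cong (≈-refl {M 1}) ∑X) ⟩
  M 1 ⊛ q^ 2 ⊕ M 1 ⊛ (((C 0 ⊕ C 1) ⊕ (C N ⊕ C (suc N))) ⊕ M 1 ⊛ ∑ (downFrom N) E)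
    ≈⟨ solve 5 (λ q y₀ y₁ c d →
        let q₁ = q :* con true; q₂ = q :* q₁; q₄ = q :* (q :* q₂)
            q₆ = q :* (q :* q₄); q₈ = q :* (q :* q₆); x = q₁ :* q₁; m = con true :+ x in
        m :* q₂ :+ m :* (((x :* x :* y₀ :+ (q₂ :* q₂) :* x :* y₁) :+ c) :+ m :* d)
        := (m :* q₂ :+ x :* x :* (y₀ :+ x :* y₀)) :+ (q₆ :* y₁ :+ q₈ :* y₁)
           :+ ((con true :+ q₄) :* d :+ m :* c))
        ≈-refl q (Y 0) (Y 1) (C N ⊕ C (suc N)) (∑ (downFrom N) E) ⟩
  (M 1 ⊛ q^ 2 ⊕ x^ 1 ⊛ x^ 1 ⊛ (Y 0 ⊕ x^ 1 ⊛ Y 0)) ⊕ (q^ 6 ⊛ Y 1 ⊕ q^ 8 ⊛ Y 1) ⊕ tail-terms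
    ≈⟨ ⊕-congʳ tail-terms (⊕-congʳ (q^ 6 ⊛ Y 1 ⊕ q^ 8 ⊛ Y 1) (⊕-congˡ (M 1 ⊛ q^ 2)
         (*-cong (≈-refl {x^ 1 ⊛ x^ 1}) (⊕-congʳ (x^ 1 ⊛ Y 0) (Y-geometric 0))))) ⟩
  (M 1 ⊛ q^ 2 ⊕ x^ 1 ⊛ x^ 1 ⊛ ((q^ 1 ⊕ x^ 1 ⊛ Y 0) ⊕ x^ 1 ⊛ Y 0)) ⊕ (q^ 6 ⊛ Y 1 ⊕ q^ 8 ⊛ Y 1) ⊕ tail-terms
    ≈⟨ solve 4 (λ q y₀ u v →
        let q₁ = q :* con true; q₂ = q :* q₁; q₄ = q :* (q :* q₂); q₅ = q :* q₄
            x = q₁ :* q₁; m = con true :+ x in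
        (m :* q₂ :+ x :* x :* ((q₁ :+ x :* y₀) :+ x :* y₀)) :+ u :+ v := ((q₂ :+ q₄ :+ q₅) :+ u) :+ v)
        ≈-refl q (Y 0) (q^ 6 ⊛ Y 1 ⊕ q^ 8 ⊛ Y 1) tail-terms ⟩
  ((q^ 2 ⊕ q^ 4 ⊕ q^ 5) ⊕ (q^ 6 ⊛ Y 1 ⊕ q^ 8 ⊛ Y 1)) ⊕ tail-terms ∎
  where
  open SetoidReasoning setoid
  open 𝔽₂[[q]] using (solve; con; _:+_; _:*_; _:=_)
  tail-terms : Series
  tail-terms = (1ₛ ⊕ q^ 4) ⊛ ∑ (downFrom N) E ⊕ M 1 ⊛ (C N ⊕ C (suc N))
  ∑X : M 1 ⊛ M 1 ⊛ M 1 ⊛ ∑ (downFrom N) X ≈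
       ((C 0 ⊕ C 1) ⊕ (C N ⊕ C (suc N))) ⊕ M 1 ⊛ ∑ (downFrom N) E
  ∑X = begin
    M 1 ⊛ M 1 ⊛ M 1 ⊛ ∑ (downFrom N) X
      ≈⟨ ∑-⊛ˡ (downFrom N) (M 1 ⊛ M 1 ⊛ M 1) X ⟨
    ∑ (downFrom N) (λ k → M 1 ⊛ M 1 ⊛ M 1 ⊛ X k)
      ≈⟨ ∑-cong (downFrom N) X-partialFractions ⟩
    ∑ (downFrom N) (λ k → (C k ⊕ C (2 + k)) ⊕ M 1 ⊛ E k)
      ≈⟨ ∑-⊕ (downFrom N) (λ k → C k ⊕ C (2 + k)) (λ k → M 1 ⊛ E k) ⟩
    ∑ (downFrom N) (λ k → C k ⊕ C (2 + k)) ⊕ ∑ (downFrom N) (λ k → M 1 ⊛ E k)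
      ≈⟨ +-cong (∑-telescope C N) (∑-⊛ˡ (downFrom N) (M 1) E) ⟩
    ((C 0 ⊕ C 1) ⊕ (C N ⊕ C (suc N))) ⊕ M 1 ⊛ ∑ (downFrom N) E ∎

-- Coefficients in degrees divisible by 4.

1⊕q^-coeff : ∀ k f n → ((1ₛ ⊕ q^ k) ⊛ f) (k + n) ≡ f (k + n) xor f n
1⊕q^-coeff k f n = trans
  (at (solve 2 (λ a f → (con true :+ a) :* f := f :+ a :* f) ≈-refl (q^ k) f) (k + n))
  (cong (f (k + n) xor_) (q^⊛-+ k f n))
  where open 𝔽₂[[q]]

-- `Y 1` is q² / (1 + q⁴), hence periodic of period 4.
Y₁-coeff : ∀ l → Y 1 (l * 4) ≡ false × Y 1 (2 + l * 4) ≡ true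
Y₁-coeff zero    = at (Y-geometric 1) 0 , at (Y-geometric 1) 2
Y₁-coeff (suc l) with p , r ← Y₁-coeff l =
  trans (step (l * 4)) p , trans (step (2 + l * 4)) r
  where
  x²≈q⁴ : x^ 2 ⊛ Y 1 ≈ q^ 4 ⊛ Y 1
  x²≈q⁴ = solve 2 (λ q y → let q₂ = q :* (q :* con true) in
    (q₂ :* q₂) :* y := (q :* (q :* q₂)) :* y) ≈-refl q (Y 1)
    where open 𝔽₂[[q]]
  step : ∀ n → Y 1 (4 + n) ≡ Y 1 n
  step n = trans (at (≈-trans (Y-geometric 1) (⊕-congˡ (q^ 2) x²≈q⁴)) (4 + n))
    (cong₂ _xor_ (q^-≢ {2} {4 + n} λ ()) (q^⊛-+ 4 (Y 1) n))

-- The fraction q^R / (1 + q^(2R)) expanded to c terms, with the remainder kept as an exact multiple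
-- of `f`.
geometric : ∀ R {f} → f ≈ q^ R ⊕ x^ R ⊛ f → ∀ c →
  f ≈ ∑ (downFrom c) (λ i → q^ ((1 + i * 2) * R)) ⊕ q^ (c * 2 * R) ⊛ f
geometric R {f} eq zero    = solve 1 (λ f → f := con false :+ con true :* f) ≈-refl f
  where open 𝔽₂[[q]]
geometric R {f} eq (suc c) = begin
  f
    ≈⟨ geometric R eq c ⟩
  s ⊕ z ⊛ f
    ≈⟨ ⊕-congˡ s (*-cong (≈-refl {z}) eq) ⟩
  s ⊕ z ⊛ (r ⊕ x^ R ⊛ f)
    ≈⟨ solve 4 (λ s z r f → s :+ z :* (r :+ (r :* r) :* f) := (r :* z :+ s) :+ r :* (r :* z) :* f)
         ≈-refl s z r f ⟩
  (r ⊛ z ⊕ s) ⊕ r ⊛ (r ⊛ z) ⊛ f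
    ≈⟨ +-cong (⊕-congʳ s (q^-+ R (c * 2 * R))) (*-cong
         (≈-trans (q^-+ R (R + c * 2 * R)) (*-cong (≈-refl {r}) (q^-+ R (c * 2 * R)))) (≈-refl {f})) ⟨
  (q^ (R + c * 2 * R) ⊕ s) ⊕ q^ (R + (R + c * 2 * R)) ⊛ f ∎
  where
  open SetoidReasoning setoid
  open 𝔽₂[[q]] using (solve; con; _:+_; _:*_; _:=_)
  s z r : Series
  s = ∑ (downFrom c) (λ i → q^ ((1 + i * 2) * R))
  z = q^ (c * 2 * R)
  r = q^ R

-- The monomial q^(1 + RC) with R = 2 + k and C = 2 + j; the shifts encode R, C ≥ 2.
product : ℕ → ℕ → Series
product k j = q^ (suc ((2 + j) * (2 + k)))

-- Expanding the middle fraction yields q^(1 + RC) for the odd C = 3, 5, 7, ..., which are the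
-- columns j = 1 + 2i.
E-geometric : ∀ c k → E k ≈
  ∑ (downFrom c) (λ i → product k (suc (i * 2))) ⊕ q^ (c * 2 * (2 + k)) ⊛ E k
E-geometric c k = begin
  a ⊛ Y (suc k)
    ≈⟨ *-cong (≈-refl {a}) (geometric (2 + k) (Y-geometric (suc k)) c) ⟩
  a ⊛ (∑ (downFrom c) f ⊕ z ⊛ Y (suc k))
    ≈⟨ solve 4 (λ a s z y → a :* (s :+ z :* y) := a :* s :+ z :* (a :* y)) ≈-refl
         a (∑ (downFrom c) f) z (Y (suc k)) ⟩
  a ⊛ ∑ (downFrom c) f ⊕ z ⊛ E k
    ≈⟨ ⊕-congʳ (z ⊛ E k) (≈-trans (≈-sym (∑-⊛ˡ (downFrom c) a f)) (∑-cong (downFrom c) term)) ⟩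
  ∑ (downFrom c) (λ i → product k (suc (i * 2))) ⊕ z ⊛ E k ∎
  where
  open SetoidReasoning setoid
  open 𝔽₂[[q]] using (solve; _:+_; _:*_; _:=_)
  a z : Series
  a = q ⊛ x^ (2 + k)
  z = q^ (c * 2 * (2 + k))
  f : ℕ → Series
  f i = q^ ((1 + i * 2) * (2 + k))
  term : ∀ i → a ⊛ f i ≈ product k (suc (i * 2))
  term i = ≈-sym (≈-trans
    (*-cong (≈-refl {q}) (≈-trans (q^-+ (2 + k) ((2 + i * 2) * (2 + k)))
      (*-cong (≈-refl {q^ (2 + k)}) (q^-+ (2 + k) ((1 + i * 2) * (2 + k))))))
    (solve 3 (λ q r f → q :* (r :* (r :* f)) := q :* (r :* r) :* f) ≈-refl q (q^ (2 + k)) (f i)))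

square%4≢3 : ∀ m → (m * m) % 4 ≢ 3
square%4≢3 m eq with m % 4 | m%n<n m 4 | trans (sym (%-distribˡ-* m m 4)) eq
... | 0 | _ | ()
... | 1 | _ | ()
... | 2 | _ | ()
... | 3 | _ | ()
... | suc (suc (suc (suc _))) | s≤s (s≤s (s≤s (s≤s ()))) | _

-- The coefficient of q^(4+4l) counts the factorisations 3+4l = RC with R, C ≥ 2 (R = 2+k),
-- which are paired off by swapping R and C.
∑E-coeff : ∀ c l → 4 + l * 4 < c → ∑ (downFrom (c * 2)) E (4 + l * 4) ≡ false
∑E-coeff c l n<c = begin
  ∑ (downFrom (c * 2)) E n
    ≡⟨ ∑-coeff (downFrom (c * 2)) row ⟩
  ∑ (downFrom (c * 2)) (λ k → ∑ (downFrom (c * 2)) (product k)) n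
    ≡⟨ at (∑-symmetric product product-sym (c * 2)) n ⟩
  ∑ (downFrom (c * 2)) (λ k → product k k) n
    ≡⟨ ∑-zero (downFrom (c * 2)) diagonal ⟩
  false ∎
  where
  open ≡-Reasoning
  n : ℕ
  n = 4 + l * 4

  n≡ : n ≡ 2 * (2 + l * 2)
  n≡ = trans (cong (λ m → 4 + m) (sym (ℕ.*-assoc l 2 2))) (ℕ.*-comm (2 + l * 2) 2)

  -- An even cofactor C makes 1 + RC odd, whereas n is even. The even columns can therefore be added
  -- to complete the square of indices.
  product-even : ∀ k i → product k (i * 2) n ≡ false
  product-even k i = q^-≢ λ eq → even≢odd (2 + l * 2) (suc i * (2 + k))
    (trans (sym n≡) (trans (sym eq) (cong suc
      (trans (cong (_* (2 + k)) (ℕ.*-comm (suc i) 2)) (ℕ.*-assoc 2 (suc i) (2 + k))))))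

  row : ∀ k → E k n ≡ ∑ (downFrom (c * 2)) (product k) n
  row k = begin
    E k n
      ≡⟨ at (E-geometric c k) n ⟩
    ∑ (downFrom c) (λ i → product k (suc (i * 2))) n xor (q^ (c * 2 * (2 + k)) ⊛ E k) n
      -- The remainder starts in degree c · 2 · (2 + k), which exceeds n because c does.
      ≡⟨ cong₂ _xor_ (sym (∑-odd (product k) (product-even k) c))
           (q^⊛-< (E k) (<-≤-trans n<c (≤-trans (m≤m*n c 2) (m≤m*n (c * 2) (2 + k))))) ⟩
    ∑ (downFrom (c * 2)) (product k) n xor false
      ≡⟨ xor-identityʳ _ ⟩
    ∑ (downFrom (c * 2)) (product k) n ∎

  product-sym : ∀ k j → product k j ≈ product j k
  product-sym k j = ≈-reflexive (cong (q^ ∘ suc) (ℕ.*-comm (2 + j) (2 + k)))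

  diagonal : ∀ k → product k k n ≡ false
  diagonal k = q^-≢ λ (eq : suc ((2 + k) * (2 + k)) ≡ 4 + l * 4) → square%4≢3 (2 + k)
    (trans (cong (_% 4) (suc-injective eq)) ([m+kn]%n≡m%n 3 l 4))

-- On the right of `S-equation` only q⁶ · `Y 1` has a nonzero coefficient in degree 8 + 4l. The
-- cutoff is even so that `∑E-coeff` applies, in degrees n and n - 4.
S-step : ∀ c l → 8 + l * 4 < c → S (c * 2) (8 + l * 4) ≡ not (S (c * 2) (l * 4))
S-step c l n<c = xor-true (trans (sym (1⊕q^-coeff 8 (S N) (l * 4)))
  (trans (at (S-equation N) n) (cong₂ _xor_ (cong₂ _xor_ monomials Y-terms) (cong₂ _xor_ E-terms C-terms))))
  where
  N n : ℕ
  N = c * 2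
  n = 8 + l * 4

  xor-true : ∀ {a b} → a xor b ≡ true → a ≡ not b
  xor-true {false} {true}  _ = refl
  xor-true {true}  {false} _ = refl

  monomials : (q^ 2 ⊕ q^ 4 ⊕ q^ 5) n ≡ false
  monomials = cong₂ _xor_ (cong₂ _xor_ (q^-≢ {2} {n} λ ()) (q^-≢ {4} {n} λ ())) (q^-≢ {5} {n} λ ())

  Y-terms : (q^ 6 ⊛ Y 1 ⊕ q^ 8 ⊛ Y 1) n ≡ true
  Y-terms with p , r ← Y₁-coeff l =
    cong₂ _xor_ (trans (q^⊛-+ 6 (Y 1) (2 + l * 4)) r) (trans (q^⊛-+ 8 (Y 1) (l * 4)) p)

  E-terms : ((1ₛ ⊕ q^ 4) ⊛ ∑ (downFrom N) E) n ≡ false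
  E-terms = trans (1⊕q^-coeff 4 (∑ (downFrom N) E) (4 + l * 4))
    (cong₂ _xor_ (∑E-coeff c (suc l) n<c) (∑E-coeff c l (≤-<-trans (ℕ.m≤n+m (4 + l * 4) 4) n<c)))

  -- The far boundary terms of the telescope are divisible by q^N, and n < N.
  C-terms : (M 1 ⊛ (C N ⊕ C (suc N))) n ≡ false
  C-terms = trans
    (at (solve 4 (λ q a y₀ y₁ →
          let x = q :* con true :* (q :* con true); m = con true :+ x; a₁ = q :* a; a₂ = q :* a₁ in
          m :* (a₁ :* a₁ :* x :* y₀ :+ a₂ :* a₂ :* x :* y₁)
          := a :* (m :* (q :* a₁ :* x :* y₀ :+ q :* q :* a₂ :* x :* y₁)))
        ≈-refl q (q^ N) (Y N) (Y (suc N))) n)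
    (q^⊛-< _ (<-≤-trans n<c (m≤m*n c 2)))
    where open 𝔽₂[[q]]

-- Simply paired partitions as pairs of sets.

copies : Bool → Bool → ℕ
copies d u = (if d then 2 else 0) + (if u then 1 else 0)

expand : ∀ {N} → Vec Bool N → Vec Bool N → List ℕ
expand             []      []      = []
expand {N = suc N} (d ∷ D) (u ∷ U) = replicate (copies d u) (suc N) ++ expand D U

Linked-replicate : ∀ k {m ps} → Linked _≥_ (m ∷ ps) → Linked _≥_ (m ∷ replicate k m ++ ps)
Linked-replicate zero    m≥ps = m≥ps
Linked-replicate (suc k) m≥ps = ≤-refl ∷ Linked-replicate k m≥ps

Linked-raise : ∀ {m n ps} → m ≤ n → Linked _≥_ (m ∷ ps) → Linked _≥_ (n ∷ ps)
Linked-raise m≤n [-]          = [-]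
Linked-raise m≤n (m≥p ∷ desc) = ≤-trans m≥p m≤n ∷ desc

expand-descending : ∀ {N} (D U : Vec Bool N) → Linked _≥_ (N ∷ expand D U)
expand-descending             []      []      = [-]
expand-descending {N = suc N} (d ∷ D) (u ∷ U) =
  Linked-replicate (copies d u) (Linked-raise (n≤1+n N) (expand-descending D U))

expand-bounded : ∀ {N} (D U : Vec Bool N) → All (_≤ N) (expand D U)
expand-bounded []      []      = []
expand-bounded (d ∷ D) (u ∷ U) =
  Allₚ.++⁺ (Allₚ.replicate⁺ (copies d u) ≤-refl) (All.map m≤n⇒m≤1+n (expand-bounded D U))

expand-positive : ∀ {N} (D U : Vec Bool N) → All (0 <_) (expand D U)
expand-positive []      []      = []
expand-positive (d ∷ D) (u ∷ U) =
  Allₚ.++⁺ (Allₚ.replicate⁺ (copies d u) (s≤s z≤n)) (expand-positive D U)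

sum-expand : ∀ {N} (D U : Vec Bool N) → sum (expand D U) ≡ weight D + weight D + weight U
sum-expand [] [] = refl
sum-expand (false ∷ D) (false ∷ U) = sum-expand D U
sum-expand {N = suc N} (false ∷ D) (true ∷ U) rewrite sum-expand D U =
  solve 3 (λ m w v → m :+ (w :+ w :+ v) := w :+ w :+ (m :+ v)) refl (suc N) (weight D) (weight U)
  where open +-*-Solver
sum-expand {N = suc N} (true ∷ D) (false ∷ U) rewrite sum-expand D U =
  solve 3 (λ m w v → m :+ (m :+ (w :+ w :+ v)) := (m :+ w) :+ (m :+ w) :+ v) refl
    (suc N) (weight D) (weight U)
  where open +-*-Solver
sum-expand {N = suc N} (true ∷ D) (true ∷ U) rewrite sum-expand D U =
  solve 3 (λ m w v → m :+ (m :+ (m :+ (w :+ w :+ v))) := (m :+ w) :+ (m :+ w) :+ (m :+ v)) refl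
    (suc N) (weight D) (weight U)
  where open +-*-Solver

multiplicity-++ : ∀ i ps qs → multiplicity i (ps ++ qs) ≡ multiplicity i ps + multiplicity i qs
multiplicity-++ i ps qs = trans (cong length (filter-++ (_≟ i) ps qs)) (length-++ (filter (_≟ i) ps))

multiplicity-absent : ∀ {i ps} → All (_≢ i) ps → multiplicity i ps ≡ 0
multiplicity-absent {i} absent = cong length (filter-none (_≟ i) absent)

multiplicity-replicate : ∀ k i → multiplicity i (replicate k i) ≡ k
multiplicity-replicate k i =
  trans (cong length (filter-all (_≟ i) (Allₚ.replicate⁺ k refl))) (length-replicate k)

multiplicity-top : ∀ {k m ps} → All (_< m) ps → multiplicity m (replicate k m ++ ps) ≡ k
multiplicity-top {k} {m} {ps} ps<m = begin
  multiplicity m (replicate k m ++ ps)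
    ≡⟨ multiplicity-++ m (replicate k m) ps ⟩
  multiplicity m (replicate k m) + multiplicity m ps
    ≡⟨ cong₂ _+_ (multiplicity-replicate k m) (multiplicity-absent (All.map <⇒≢ ps<m)) ⟩
  k + 0
    ≡⟨ ℕ.+-identityʳ k ⟩
  k ∎
  where open ≡-Reasoning

multiplicity-rest : ∀ {i k m ps} → i ≢ m → multiplicity i (replicate k m ++ ps) ≡ multiplicity i ps
multiplicity-rest {i} {k} {m} {ps} i≢m = trans (multiplicity-++ i (replicate k m) ps)
  (cong (_+ multiplicity i ps) (multiplicity-absent (Allₚ.replicate⁺ k (i≢m ∘ sym))))

multiplicity-expand-≤3 : ∀ {N} (D U : Vec Bool N) i → multiplicity i (expand D U) ≤ 3
multiplicity-expand-≤3 [] [] i = z≤n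
multiplicity-expand-≤3 {N = suc N} (d ∷ D) (u ∷ U) i with i ≟ suc N
... | yes refl = ≤-trans
  (≤-reflexive (multiplicity-top {copies d u} (All.map s≤s (expand-bounded D U)))) (copies≤3 d u)
  where
  copies≤3 : ∀ d u → copies d u ≤ 3
  copies≤3 false false = z≤n
  copies≤3 false true  = s≤s z≤n
  copies≤3 true  false = s≤s (s≤s z≤n)
  copies≤3 true  true  = s≤s (s≤s (s≤s z≤n))
... | no i≢ = ≤-trans (≤-reflexive (multiplicity-rest {k = copies d u} i≢)) (multiplicity-expand-≤3 D U i)

-- The tests in `largestRepeated` and `oddParts` refer to the whole list, so they change when the
-- top part is removed; on the remaining parts they agree.
filter-cong : ∀ {A : Set} {P Q : Pred A 0ℓ} (P? : Decidable P) (Q? : Decidable Q) {xs} →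
              All (λ x → does (P? x) ≡ does (Q? x)) xs → filter P? xs ≡ filter Q? xs
filter-cong P? Q? []                    = refl
filter-cong P? Q? (_∷_ {x} eq eqs) rewrite eq with does (Q? x)
... | true  = cong (x ∷_) (filter-cong P? Q? eqs)
... | false = filter-cong P? Q? eqs

multiplicities-rest : ∀ k {m ps} → All (_< m) ps →
  All (λ i → multiplicity i (replicate k m ++ ps) ≡ multiplicity i ps) ps
multiplicities-rest k = All.map λ i<m → multiplicity-rest {k = k} (<⇒≢ i<m)

-- If N + 1 belongs to D, it is repeated and bounds every other part. Otherwise it occurs at most
-- once and drops out, while the smaller parts keep their multiplicities.
largestRepeated-expand : ∀ {N} (D U : Vec Bool N) → largestRepeated (expand D U) ≡ top D
largestRepeated-expand [] [] = refl
largestRepeated-expand (false ∷ D) (false ∷ U) = largestRepeated-expand D U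
largestRepeated-expand {N = suc N} (false ∷ D) (true ∷ U) = begin
  max 0 (filter repeated? (suc N ∷ ps))
    ≡⟨ cong (max 0) (filter-reject repeated? {suc N} {ps} ¬repeated) ⟩
  max 0 (filter repeated? ps)
    ≡⟨ cong (max 0) (filter-cong repeated? (λ i → 2 ≤? multiplicity i ps)
         (All.map (cong (λ k → does (2 ≤? k))) (multiplicities-rest 1 ps<))) ⟩
  largestRepeated ps
    ≡⟨ largestRepeated-expand D U ⟩
  top D ∎
  where
  open ≡-Reasoning
  ps : List ℕ
  ps = expand D U
  ps< : All (_< suc N) ps
  ps< = All.map s≤s (expand-bounded D U)
  repeated? : Decidable (λ i → 2 ≤ multiplicity i (suc N ∷ ps))
  repeated? i = 2 ≤? multiplicity i (suc N ∷ ps)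
  ¬repeated : ¬ (2 ≤ multiplicity (suc N) (suc N ∷ ps))
  ¬repeated 2≤m with s≤s () ← ≤-trans 2≤m (≤-reflexive (multiplicity-top {1} ps<))
largestRepeated-expand {N = suc N} (true ∷ D) (u ∷ U) =
  max≈v⁺ (∈-filter⁺ repeated? (here refl) repeated)
    (Allₚ.filter⁺ repeated? (expand-bounded (true ∷ D) (u ∷ U))) z≤n
  where
  ps : List ℕ
  ps = expand (true ∷ D) (u ∷ U)
  repeated? : Decidable (λ i → 2 ≤ multiplicity i ps)
  repeated? i = 2 ≤? multiplicity i ps
  repeated : 2 ≤ multiplicity (suc N) ps
  repeated = ≤-trans (s≤s (s≤s z≤n))
    (≤-reflexive (sym (multiplicity-top {copies true u} (All.map s≤s (expand-bounded D U)))))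

deduplicate-replicate : ∀ k {m ps} → All (_< m) ps →
  deduplicate _≟_ (replicate (suc k) m ++ ps) ≡ m ∷ deduplicate _≟_ ps
deduplicate-replicate zero    {m} ps<m =
  cong (m ∷_) (filter-all (¬? ∘ (m ≟_)) (Allₚ.deduplicate⁺ _≟_ (All.map >⇒≢ ps<m)))
deduplicate-replicate (suc k) {m} ps<m = cong (m ∷_)
  (trans (cong (filter (¬? ∘ (m ≟_))) (deduplicate-replicate k ps<m))
    (trans (filter-reject (¬? ∘ (m ≟_)) (λ m≢m → m≢m refl))
      (filter-all (¬? ∘ (m ≟_)) (Allₚ.deduplicate⁺ _≟_ (All.map >⇒≢ ps<m)))))

filter-∷ : ∀ {A : Set} {P : Pred A 0ℓ} (P? : Decidable P) x xs →
           filter P? (x ∷ xs) ≡ (if does (P? x) then x ∷ filter P? xs else filter P? xs)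
filter-∷ P? x xs with does (P? x)
... | true  = refl
... | false = refl

oddParts-replicate : ∀ k {m ps} → All (_< m) ps →
  oddParts (replicate (suc k) m ++ ps) ≡ (if does (suc k % 2 ≟ 1) then m ∷ oddParts ps else oddParts ps)
oddParts-replicate k {m} {ps} ps<m = begin
  filter odd? (deduplicate _≟_ (replicate (suc k) m ++ ps))
    ≡⟨ cong (filter odd?) (deduplicate-replicate k ps<m) ⟩
  filter odd? (m ∷ deduplicate _≟_ ps)
    ≡⟨ filter-∷ odd? m (deduplicate _≟_ ps) ⟩
  (if does (odd? m) then m ∷ filter odd? (deduplicate _≟_ ps) else filter odd? (deduplicate _≟_ ps))
    ≡⟨ cong₂ (λ j us → if does (j % 2 ≟ 1) then m ∷ us else us)
         (multiplicity-top {suc k} ps<m)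
         (filter-cong odd? (λ i → multiplicity i ps % 2 ≟ 1)
           (All.map (cong (λ j → does (j % 2 ≟ 1)))
             (Allₚ.deduplicate⁺ _≟_ (multiplicities-rest (suc k) ps<m)))) ⟩
  (if does (suc k % 2 ≟ 1) then m ∷ oddParts ps else oddParts ps) ∎
  where
  open ≡-Reasoning
  odd? : Decidable (λ i → multiplicity i (replicate (suc k) m ++ ps) % 2 ≡ 1)
  odd? i = multiplicity i (replicate (suc k) m ++ ps) % 2 ≟ 1

-- The multiplicity 2d + u is odd exactly when u is true, so the odd parts are the elements of U. By
-- `altSum≤` integer and natural subtraction agree.
alternatingSum-expand : ∀ {N} (D U : Vec Bool N) →
                        alternatingSum (oddParts (expand D U)) ≡ + altSum U
alternatingSum-expand [] [] = refl
alternatingSum-expand {N = suc N} (d ∷ D) (u ∷ U) = go d u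
  where
  ps : List ℕ
  ps = expand D U
  ps< : All (_< suc N) ps
  ps< = All.map s≤s (expand-bounded D U)
  odd-top : alternatingSum (suc N ∷ oddParts ps) ≡ + (suc N ∸ altSum U)
  odd-top rewrite alternatingSum-expand D U =
    trans (ℤₚ.m-n≡m⊖n (suc N) (altSum U)) (ℤₚ.⊖-≥ (m≤n⇒m≤1+n (altSum≤ U)))
  go : ∀ d u → alternatingSum (oddParts (expand (d ∷ D) (u ∷ U))) ≡ + altSum (u ∷ U)
  go false false = alternatingSum-expand D U
  go false true  = trans (cong alternatingSum (oddParts-replicate 0 ps<)) odd-top
  go true  false = trans (cong alternatingSum (oddParts-replicate 1 ps<)) (alternatingSum-expand D U)
  go true  true  = trans (cong alternatingSum (oddParts-replicate 2 ps<)) odd-top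

pairingRank-expand : ∀ {N} (D U : Vec Bool N) →
  pairingRank (expand D U) ≡ ℤ.- (+ 2) ⇔ altSum U ≡ 2 + top D
pairingRank-expand D U rewrite largestRepeated-expand D U | alternatingSum-expand D U = mk⇔ to from
  where
  open ℤ-Solver
  to : + top D ℤ.- + altSum U ≡ ℤ.- (+ 2) → altSum U ≡ 2 + top D
  to eq = trans (ℤₚ.+-injective (trans
    (solve 2 (λ t a → a := t :- (t :- a)) refl (+ top D) (+ altSum U))
    (cong (ℤ._-_ (+ top D)) eq))) (ℕ.+-comm (top D) 2)
  from : altSum U ≡ 2 + top D → + top D ℤ.- + altSum U ≡ ℤ.- (+ 2)
  from eq = trans (cong (λ a → + top D ℤ.- + a) eq)
    (solve 1 (λ t → t :- (con (+ 2) :+ t) := :- con (+ 2)) refl (+ top D))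

copies-injective : ∀ d u d′ u′ → copies d u ≡ copies d′ u′ → d ≡ d′ × u ≡ u′
copies-injective false false false false _ = refl , refl
copies-injective false true  false true  _ = refl , refl
copies-injective true  false true  false _ = refl , refl
copies-injective true  true  true  true  _ = refl , refl
copies-injective false false false true  ()
copies-injective false false true  false ()
copies-injective false false true  true  ()
copies-injective false true  false false ()
copies-injective false true  true  false ()
copies-injective false true  true  true  ()
copies-injective true  false false false ()
copies-injective true  false false true  ()
copies-injective true  false true  true  ()
copies-injective true  true  false false ()
copies-injective true  true  false true  ()
copies-injective true  true  true  false ()

multiplicity-top-expand : ∀ {N} d u (D U : Vec Bool N) →
                          multiplicity (suc N) (expand (d ∷ D) (u ∷ U)) ≡ copies d u
multiplicity-top-expand d u D U = multiplicity-top {copies d u} (All.map s≤s (expand-bounded D U))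

-- The multiplicity of the largest candidate determines both heads; the common prefix then cancels.
expand-injective : ∀ {N} (D U D′ U′ : Vec Bool N) → expand D U ≡ expand D′ U′ → D ≡ D′ × U ≡ U′
expand-injective [] [] [] [] _ = refl , refl
expand-injective {N = suc N} (d ∷ D) (u ∷ U) (d′ ∷ D′) (u′ ∷ U′) eq
  with refl , refl ← copies-injective d u d′ u′ (trans (sym (multiplicity-top-expand d u D U))
         (trans (cong (multiplicity (suc N)) eq) (multiplicity-top-expand d′ u′ D′ U′)))
  with refl , refl ← expand-injective D U D′ U′ (++-cancelˡ (replicate (copies d u) (suc N)) _ _ eq)
  = refl , refl

splitTop : ∀ {N} ps → Linked _≥_ (suc N ∷ ps) →
           ∃₂ λ k qs → ps ≡ replicate k (suc N) ++ qs × Linked _≥_ (N ∷ qs)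
splitTop {N} [] _ = 0 , [] , refl , [-]
splitTop {N} (p ∷ ps) (N≥p ∷ desc) with p ≟ suc N
... | no  p≢    = 0 , p ∷ ps , refl , s≤s⁻¹ (≤∧≢⇒< N≥p p≢) ∷ desc
... | yes refl with k , qs , refl , desc′ ← splitTop ps desc = suc k , qs , refl , desc′

-- The copies of the largest candidate form a prefix. Their number is at most 3, hence of the form
-- 2d + u, and the rest inherits the bound.
expand-surjective : ∀ N ps → Linked _≥_ (N ∷ ps) → All (0 <_) ps → (∀ i → multiplicity i ps ≤ 3) →
                    ∃₂ λ (D U : Vec Bool N) → ps ≡ expand D U
expand-surjective zero    []          _             _            _  = [] , [] , refl
expand-surjective zero    (suc p ∷ _) (() ∷ _)      _            _
expand-surjective zero    (zero ∷ _)  _             (() ∷ _)     _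
expand-surjective (suc N) ps desc pos ≤3
  with k , qs , refl , desc′ ← splitTop ps desc
  with D , U , refl ← expand-surjective N qs desc′ (Allₚ.++⁻ʳ (replicate k (suc N)) pos)
         (λ i → m+n≤o⇒n≤o (multiplicity i (replicate k (suc N)))
            (≤-trans (≤-reflexive (sym (multiplicity-++ i (replicate k (suc N)) qs))) (≤3 i)))
  with k | ≤-trans (≤-reflexive (sym (multiplicity-top {k} (All.map s≤s (expand-bounded D U))))) (≤3 (suc N))
... | 0 | _ = false ∷ D , false ∷ U , refl
... | 1 | _ = false ∷ D , true ∷ U , refl
... | 2 | _ = true ∷ D , false ∷ U , refl
... | 3 | _ = true ∷ D , true ∷ U , refl
... | suc (suc (suc (suc _))) | s≤s (s≤s (s≤s ()))

-- Enumeration of the pairs and the resulting count.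

∈-subsets : ∀ {N} (U : Vec Bool N) → U ∈ subsets N
∈-subsets []          = here refl
∈-subsets (false ∷ U) = ∈-++⁺ˡ (∈-map⁺ (false ∷_) (∈-subsets U))
∈-subsets {suc N} (true ∷ U)  = ∈-++⁺ʳ (map (false ∷_) (subsets N)) (∈-map⁺ (true ∷_) (∈-subsets U))

subsets-unique : ∀ N → Unique (subsets N)
subsets-unique zero    = [] ∷ []
subsets-unique (suc N) = Uniqueₚ.++⁺
  (Uniqueₚ.map⁺ ∷-injectiveʳ (subsets-unique N)) (Uniqueₚ.map⁺ ∷-injectiveʳ (subsets-unique N))
  λ (∈₁ , ∈₂) → case-heads (∈-map⁻ (false ∷_) ∈₁) (∈-map⁻ (true ∷_) ∈₂)
  where
  case-heads : ∀ {U : Vec Bool (suc N)} →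
    ∃ (λ V → V ∈ subsets N × U ≡ false ∷ V) → ∃ (λ V → V ∈ subsets N × U ≡ true ∷ V) → ⊥
  case-heads (_ , _ , refl) (_ , _ , ())

Valid : ∀ {N} → ℕ → Vec Bool N × Vec Bool N → Set
Valid n (D , U) = (weight D + weight D + weight U ≡ n) × (altSum U ≡ 2 + top D)

valid? : ∀ {N} n → Decidable (Valid {N} n)
valid? n (D , U) = (weight D + weight D + weight U ≟ n) ×-dec (altSum U ≟ 2 + top D)

pairs : ∀ N → List (Vec Bool N × Vec Bool N)
pairs N = cartesianProduct (subsets N) (subsets N)

Counted : List ℕ → Set
Counted ps = SimplyPaired ps × pairingRank ps ≡ ℤ.- (+ 2)

counted? : Decidable Counted
counted? ps = simplyPaired? ps ×-dec (pairingRank ps ℤₚ.≟ ℤ.- (+ 2))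

-- `SimplyPaired` bounds only the multiplicities of actual parts; any other number has multiplicity
-- 0.
paired-all : ∀ {ps} → SimplyPaired ps → ∀ i → multiplicity i ps ≤ 3
paired-all {ps} paired i with i ∈? ps
... | yes i∈ = All.lookup paired i∈
... | no  i∉ = ≤-trans (≤-reflexive (multiplicity-absent (All.map (_∘ sym) (Allₚ.¬Any⇒All¬ ps i∉)))) z≤n

Linked-bound : ∀ {n N ps} → n ≤ N → Linked _≥_ ps → sum ps ≡ n → Linked _≥_ (N ∷ ps)
Linked-bound {ps = []}     n≤N _    _    = [-]
Linked-bound {ps = p ∷ ps} n≤N desc refl = ≤-trans (m≤m+n p (sum ps)) n≤N ∷ desc

∈-counted⇔ : ∀ {n N} → n ≤ N → ∀ {ps} →
  ps ∈ filter counted? (partitions n) ⇔ ps ∈ map (uncurry expand) (filter (valid? n) (pairs N))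
∈-counted⇔ {n} {N} n≤N = mk⇔ to from
  where
  to : ∀ {ps} → ps ∈ filter counted? (partitions n) →
       ps ∈ map (uncurry expand) (filter (valid? n) (pairs N))
  to {ps} ps∈ with ps∈′ , paired , rank ← ∈-filter⁻ counted? ps∈
    with record { positive = pos ; descending = desc ; total = total } ← Equivalence.to ∈-partitions ps∈′
    with D , U , refl ← expand-surjective N ps (Linked-bound n≤N desc total) pos (paired-all paired)
    = ∈-map⁺ (uncurry expand) (∈-filter⁺ (valid? n)
        (∈-cartesianProduct⁺ (∈-subsets D) (∈-subsets U))
        (trans (sym (sum-expand D U)) total , Equivalence.to (pairingRank-expand D U) rank))

  from : ∀ {ps} → ps ∈ map (uncurry expand) (filter (valid? n) (pairs N)) →
         ps ∈ filter counted? (partitions n)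
  from ps∈ with (D , U) , DU∈ , refl ← ∈-map⁻ (uncurry expand) ps∈
    with _ , total , rank ← ∈-filter⁻ (valid? n) {xs = pairs N} DU∈
    = ∈-filter⁺ counted?
        (Equivalence.from ∈-partitions record
          { positive = expand-positive D U
          ; descending = Linked.tail (expand-descending D U)
          ; total = trans (sum-expand D U) total })
        (All.universal (multiplicity-expand-≤3 D U) (expand D U)
        , Equivalence.from (pairingRank-expand D U) rank)

-- Both lists are free of duplicates and have the same members, so they are permutations of each
-- other. Every cutoff N ≥ n is allowed, since no part of a partition of n exceeds n.
A₂-pairs : ∀ {n N} → n ≤ N → A₂ n ≡ length (filter (valid? n) (pairs N))
A₂-pairs {n} {N} n≤N = trans
  (↭-length (∼bag⇒↭ (unique∧set⇒bag
    (Uniqueₚ.filter⁺ counted? (partitions-unique n))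
    (Uniqueₚ.map⁺ (λ {(D , U)} {(D′ , U′)} eq → uncurry (cong₂ _,_) (expand-injective D U D′ U′ eq))
      (Uniqueₚ.filter⁺ (valid? n) (Uniqueₚ.cartesianProduct⁺ (subsets-unique N) (subsets-unique N))))
    (∈-counted⇔ n≤N))))
  (length-map (uncurry expand) (filter (valid? n) (pairs N)))

-- The parity of the count as a coefficient.

parity : ℕ → Bool
parity zero    = false
parity (suc n) = not (parity n)

bit : Bool → ℕ
bit b = if b then 1 else 0

%2-parity : ∀ n → n % 2 ≡ bit (parity n)
%2-parity 0 = refl
%2-parity 1 = refl
%2-parity (suc (suc n)) =
  trans (%2-parity n) (cong bit (sym (not-involutive (parity n))))

-- Counting modulo 2 is adding coefficients in 𝔽₂; this is the passage from lists to series.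
parity-length-filter : ∀ {A : Set} {P : Pred A 0ℓ} (P? : Decidable P) (f : A → Series) n →
  (∀ x → does (P? x) ≡ f x n) → ∀ xs → parity (length (filter P? xs)) ≡ ∑ xs f n
parity-length-filter P? f n P?≡f []       = refl
parity-length-filter P? f n P?≡f (x ∷ xs) rewrite sym (P?≡f x) with does (P? x)
... | true  = cong not (parity-length-filter P? f n P?≡f xs)
... | false = parity-length-filter P? f n P?≡f xs

∑-cartesianProduct : ∀ {A B : Set} (xs : List A) (ys : List B) f →
  ∑ (cartesianProduct xs ys) f ≈ ∑ xs (λ x → ∑ ys (λ y → f (x , y)))
∑-cartesianProduct []       ys f = ≈-refl
∑-cartesianProduct (x ∷ xs) ys f = ≈-trans (∑-++ (map (x ,_) ys) (cartesianProduct xs ys) f)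
  (+-cong (≈-reflexive (∑-map (x ,_) ys f)) (∑-cartesianProduct xs ys f))

q^-coeff : ∀ k n → q^ k n ≡ does (k ≟ n)
q^-coeff k n with k ≟ n
... | yes refl = trans (q^-refl k) (sym (dec-true (k ≟ k) refl))
... | no  k≢n  = trans (q^-≢ k≢n) (sym (dec-false (k ≟ n) k≢n))

pairTerm : ∀ {N} → Vec Bool N × Vec Bool N → Series
pairTerm (D , U) = x^ (weight D) ⊛ selectAltSum (2 + top D) U

valid-coeff : ∀ {N} n (DU : Vec Bool N × Vec Bool N) → does (valid? n DU) ≡ pairTerm DU n
valid-coeff n (D , U) with altSum U ≡ᵇ 2 + top D
... | true  = trans (∧-identityʳ _) (sym
  (trans (at monomial n) (q^-coeff (weight D + weight D + weight U) n)))
  where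
  monomial : x^ (weight D) ⊛ q^ (weight U) ≈ q^ (weight D + weight D + weight U)
  monomial = ≈-sym (≈-trans (q^-+ (weight D + weight D) (weight U))
    (*-cong (q^-+ (weight D) (weight D)) (≈-refl {q^ (weight U)})))
... | false = trans (∧-zeroʳ _) (sym (at (zeroʳ (x^ (weight D))) n))

-- Summing over U first gives `G (2 + top D)` up to degree N; grouping the sets D by their maximum
-- then gives `S N`.
A₂-parity : ∀ {n N} → n ≤ N → parity (A₂ n) ≡ S N n
A₂-parity {n} {N} n≤N = begin
  parity (A₂ n)
    ≡⟨ cong parity (A₂-pairs n≤N) ⟩
  parity (length (filter (valid? n) (pairs N)))
    ≡⟨ parity-length-filter (valid? n) pairTerm n (valid-coeff n) (pairs N) ⟩
  ∑ (pairs N) pairTerm n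
    ≡⟨ at (∑-cartesianProduct (subsets N) (subsets N) pairTerm) n ⟩
  ∑ (subsets N) (λ D → ∑ (subsets N) (λ U → x^ (weight D) ⊛ selectAltSum (2 + top D) U)) n
    ≡⟨ ∑-coeff (subsets N) (λ D → trans
         (at (∑-⊛ˡ (subsets N) (x^ (weight D)) (selectAltSum (2 + top D))) n)
         (⊛-cong-≤ (x^ (weight D)) λ m≤n → distinct-G (2 + top D) (≤-trans m≤n n≤N))) ⟩
  ∑ (subsets N) (λ D → x^ (weight D) ⊛ G (2 + top D)) n
    ≡⟨ at (∑-by-top N (λ t → G (2 + t))) n ⟩
  S N n ∎
  where open ≡-Reasoning

-- The recurrence and the residues modulo 16.

A₂-parity-step : ∀ l → parity (A₂ (8 + l * 4)) ≡ not (parity (A₂ (l * 4)))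
A₂-parity-step l = begin
  parity (A₂ n)             ≡⟨ A₂-parity n≤N ⟩
  S N n                     ≡⟨ S-step (suc n) l (n<1+n n) ⟩
  not (S N (l * 4))         ≡⟨ cong not (A₂-parity (≤-trans (ℕ.m≤n+m (l * 4) 8) n≤N)) ⟨
  not (parity (A₂ (l * 4))) ∎
  where
  open ≡-Reasoning
  n N : ℕ
  n = 8 + l * 4
  -- An even cutoff 2c with c > n, as `S-step` requires; it also exceeds n - 8.
  N = suc n * 2
  n≤N : n ≤ N
  n≤N = ≤-trans (n≤1+n n) (ℕ.m≤m*n (suc n) 2)

-- The sequence 0, 1, 1, 0 of period 4, defined by the same two-step recursion as `A₂-parity-step`.
parityPattern : ℕ → Bool
parityPattern 0             = false
parityPattern 1             = true
parityPattern (suc (suc l)) = not (parityPattern l)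

A₂-parityPattern : ∀ l → parity (A₂ (l * 4)) ≡ parityPattern l
-- The two initial values, at n = 0 and n = 4, are found by evaluating `A₂`.
A₂-parityPattern 0             = refl
A₂-parityPattern 1             = refl
A₂-parityPattern (suc (suc l)) = trans (A₂-parity-step l) (cong not (A₂-parityPattern l))

parityPattern-periodic : ∀ r n → parityPattern (n * 4 + r) ≡ parityPattern r
parityPattern-periodic r zero    = refl
parityPattern-periodic r (suc n) =
  trans (not-involutive (parityPattern (n * 4 + r))) (parityPattern-periodic r n)

A₂-%2 : ∀ {m} r n → m ≡ (n * 4 + r) * 4 → A₂ m % 2 ≡ bit (parityPattern r)
A₂-%2 {m} r n refl = trans (%2-parity (A₂ m))
  (cong bit (trans (A₂-parityPattern (n * 4 + r)) (parityPattern-periodic r n)))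

corollary7p4 : ∀ (n : ℕ) →
    (A₂ (16 * n) % 2 ≡ 0) ×
    (A₂ (16 * n + 4) % 2 ≡ 1) ×
    (A₂ (16 * n + 8) % 2 ≡ 1) ×
    (A₂ (16 * n + 12) % 2 ≡ 0)
corollary7p4 n =
    A₂-%2 0 n (solve 1 (λ n → con 16 :* n := (n :* con 4 :+ con 0) :* con 4) refl n)
  , A₂-%2 1 n (regroup 1)
  , A₂-%2 2 n (regroup 2)
  , A₂-%2 3 n (regroup 3)
  where
  open +-*-Solver
  regroup : ∀ r → 16 * n + r * 4 ≡ (n * 4 + r) * 4
  regroup r = solve 2 (λ n r → con 16 :* n :+ r :* con 4 := (n :* con 4 :+ r) :* con 4) refl n r
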